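{- Let $k\ge 0$ be an integer and let $G$ be a finite graph of treewidth $k$ and maximum degree $\Delta(G) \geq (k+3)^2/2$. Then $\mathrm{ch}'(G) = \Delta(G)$.
   Context: A tree decomposition of a graph $G$ is a pair $(T,\{V_t\}_{t\in V(T)})$ where $T$ is a tree and $V_t\subseteq V(G)$ are bags such that every vertex of $G$ lies in some bag, both endpoints of every edge lie in a common bag, and for each vertex $v$ the set of $t$ with $v\in V_t$ induces a connected subtree of $T$. Its width is the maximum bag size minus one, and the treewidth of $G$ is the minimum width of a tree decomposition of $G$. An assignment of lists is a map $L$ from $E(G)$ to subsets of $\mathbb{N}$; an $L$-edge-colouring is a map $\gamma$ on $E(G)$ with $\gamma(e)\in L(e)$ for all $e$ such that any two edges sharing an endvertex receive different colours. The list chromatic index $\mathrm{ch}'(G)$ is the smallest integer $m$ such that for every assignment of lists $L$ with $|L(e)|=m$ for all edges $e$, there is an $L$-edge-colouring of $G$. -}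

module Defs where

open import Data.Nat using (ℕ; zero; suc; _+_; _*_; _^_; _≤_; _⊔_)
open import Data.Bool using (Bool; true; false; T; if_then_else_)
open import Data.Fin using (Fin) renaming (_<_ to _<ᶠ_)
open import Data.List using (List; []; _∷_; _++_; length; map; foldr; allFin)
open import Data.Nat.ListAction using (sum)
open import Data.List.Relation.Unary.Linked using (Linked)
open import Data.List.Relation.Unary.Unique.Propositional using (Unique)
open import Data.List.Membership.Propositional using (_∈_)
open import Data.Product using (Σ; Σ-syntax; ∃; ∃-syntax; _×_; _,_; proj₁; proj₂)
open import Data.Sum using (_⊎_)
open import Data.Unit using (⊤)
open import Data.Empty using (⊥)
open import Relation.Binary.PropositionalEquality using (_≡_; _≢_)
open import Relation.Nullary using (¬_)

record Graph : Set where
  field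
    n      : ℕ
    adj    : Fin n → Fin n → Bool
    sym    : ∀ u v → adj u v ≡ adj v u
    irrefl : ∀ v → adj v v ≡ false

open Graph public

Vertex : Graph → Set
Vertex G = Fin (n G)

Adj : (G : Graph) → Vertex G → Vertex G → Set
Adj G u v = T (adj G u v)

countTrue : List Bool → ℕ
countTrue bs = sum (map (λ b → if b then 1 else 0) bs)

degree : (G : Graph) → Vertex G → ℕ
degree G v = countTrue (map (adj G v) (allFin (n G)))

maxDegree : Graph → ℕ
maxDegree G = foldr _⊔_ 0 (map (degree G) (allFin (n G)))

data WalkIn (G : Graph) (P : Vertex G → Set) : Vertex G → Vertex G → Set where
  here : ∀ {v} → P v → WalkIn G P v v
  step : ∀ {u w v} → P u → Adj G u w → WalkIn G P w v → WalkIn G P u v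

Connected : Graph → Set
Connected G = ∀ u v → WalkIn G (λ _ → ⊤) u v

IsCycle : (G : Graph) → List (Vertex G) → Set
IsCycle G []       = ⊥
IsCycle G (x ∷ xs) =
  (3 ≤ length (x ∷ xs)) × Unique (x ∷ xs) ×
  Linked (Adj G) ((x ∷ xs) ++ (x ∷ []))

Acyclic : Graph → Set
Acyclic G = ∀ cs → ¬ IsCycle G cs

IsTree : Graph → Set
IsTree T' = (1 ≤ n T') × Connected T' × Acyclic T'

record TreeDecomposition (G : Graph) : Set₁ where
  field
    tree    : Graph
    isTree  : IsTree tree
    bag     : Vertex tree → Vertex G → Bool
    covers  : ∀ v → ∃[ t ] T (bag t v)
    edgeIn  : ∀ u v → Adj G u v → ∃[ t ] (T (bag t u) × T (bag t v))
    subtree : ∀ v s t → T (bag s v) → T (bag t v) →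
              WalkIn tree (λ r → T (bag r v)) s t

open TreeDecomposition public

bagSize : {G : Graph} (D : TreeDecomposition G) → Vertex (tree D) → ℕ
bagSize {G} D t = countTrue (map (bag D t) (allFin (n G)))

-- width ≤ w  ⇔  every bag has at most w + 1 vertices
-- (avoids truncated subtraction in "max bag size − 1")
WidthAtMost : {G : Graph} → TreeDecomposition G → ℕ → Set
WidthAtMost D w = ∀ t → bagSize D t ≤ suc w

-- treewidth G = k : some decomposition has width ≤ k, and none has width ≤ k − 1,
-- i.e. none has all bags of size ≤ k.
TreewidthEq : Graph → ℕ → Set₁
TreewidthEq G k =
  (Σ[ D ∈ TreeDecomposition G ] WidthAtMost D k) ×
  (¬ (Σ[ D ∈ TreeDecomposition G ] (∀ t → bagSize D t ≤ k)))

Edge : Graph → Set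
Edge G = Σ[ u ∈ Vertex G ] Σ[ v ∈ Vertex G ] (u <ᶠ v × Adj G u v)

end₁ end₂ : {G : Graph} → Edge G → Vertex G
end₁ (u , _ , _) = u
end₂ (_ , v , _) = v

ShareEnd : (G : Graph) → Edge G → Edge G → Set
ShareEnd G e f = (end₁ {G} e ≡ end₁ {G} f) ⊎ (end₁ {G} e ≡ end₂ {G} f) ⊎
                 (end₂ {G} e ≡ end₁ {G} f) ⊎ (end₂ {G} e ≡ end₂ {G} f)

ListAssignment : Graph → ℕ → Set
ListAssignment G m =
  Σ[ L ∈ (Edge G → List ℕ) ] (∀ e → Unique (L e) × length (L e) ≡ m)

IsLEdgeColouring : (G : Graph) → (Edge G → List ℕ) → (Edge G → ℕ) → Set
IsLEdgeColouring G L γ =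
  (∀ e → γ e ∈ L e) ×
  (∀ e f → e ≢ f → ShareEnd G e f → γ e ≢ γ f)

EdgeChoosable : Graph → ℕ → Set
EdgeChoosable G m =
  ∀ (A : ListAssignment G m) → Σ[ γ ∈ (Edge G → ℕ) ] IsLEdgeColouring G (proj₁ A) γ

ListChromaticIndexEq : Graph → ℕ → Set
ListChromaticIndexEq G m = EdgeChoosable G m × (∀ m' → EdgeChoosable G m' → m ≤ m')

{-# OPTIONS --safe #-}

-- Let m be the maximum degree. By induction, every subgraph A of G can be coloured from lists
-- of length m.
--
-- If some edge of A has ends of degree sum at most m + 1, colour the rest of A and then this
-- edge greedily. Otherwise call a vertex big if its degree in A exceeds k; every edge has a big
-- end. Root the tree of the decomposition and take a big vertex v whose topmost bag t is as
-- deep as possible. The neighbours of v outside t are small, and all their neighbours are big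
-- and lie in t. Since 2m ≥ (k + 3)², there are more than k(k + 1)/2 such neighbours, so after
-- discarding the vertices of t that see few of them there remain U ⊆ t and a nonempty W such
-- that W has all its neighbours in U and each u in U has at least |U| neighbours in W.
--
-- Colour the edges not meeting W. An edge uw with u in U and w in W keeps at least as many
-- colours as u has neighbours in W, which is at least the degree of u and of w in the bipartite
-- graph H of the edges meeting W. By the theorem of Borodin, Kostochka and Woodall, H is then
-- list-colourable: a König colouring c of H with c(uw) < deg u, obtained by Kempe chains, gives
-- the preferences for Galvin's kernel argument.
module Submission where

open import Defs
open import Data.Nat using (ℕ; zero; suc; _+_; _*_; _^_; _≤_; _<_; _⊔_; z≤n; s≤s; z<s; s≤s⁻¹; _≤?_; _<?_)
open import Data.Nat.Properties hiding (_≟_)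
import Data.Nat.Properties as ℕₚ
open import Data.Nat.Tactic.RingSolver using (solve-∀)
open import Data.Bool using (Bool; true; false; T)
import Data.Bool.Properties as Boolₚ
import Data.Fin as Fin
import Data.Fin.Properties as Finₚ
open import Data.List using (List; []; _∷_; _++_; length; map; filter; foldr; allFin; upTo; concatMap; deduplicate)
open import Data.List.Properties using (length-map; length-++; length-upTo; filter-notAll; filter-all)
open import Data.List.Membership.Propositional using (_∈_; _∉_; find; lose)
open import Data.List.Membership.Propositional.Properties
open import Data.List.Relation.Unary.Any using (Any; any?; here; there)
open import Data.List.Relation.Unary.All as All using (All; []; _∷_)
open import Data.List.Relation.Unary.AllPairs using ([]; _∷_)
open import Data.List.Relation.Unary.Linked using (Linked; []; [-]; _∷_)
open import Data.List.Relation.Unary.Unique.Propositional using (Unique)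
import Data.List.Relation.Unary.Unique.Propositional.Properties as Uniqueₚ
open import Data.List.Relation.Unary.Unique.DecPropositional.Properties using (deduplicate-!)
open import Data.List.Extrema.Nat using (argmin; argmax; argmin-sel; argmax-sel; f[argmin]≤f[xs]; f[xs]≤f[argmax])
open import Data.Product using (Σ-syntax; ∃-syntax; _×_; _,_; proj₁; proj₂)
open import Data.Sum using (_⊎_; inj₁; inj₂; [_,_]′)
open import Data.Empty using (⊥-elim)
open import Function using (_∘_; id; case_of_)
open import Relation.Binary using (DecidableEquality; tri<; tri≈; tri>)
open import Relation.Binary.PropositionalEquality using (_≡_; _≢_; refl; trans; cong; cong₂; subst; subst₂) renaming (sym to ≡-sym)
open import Relation.Nullary using (¬_; yes; no; contradiction)
open import Relation.Nullary.Decidable using (T?; ¬?; _×-dec_; _⊎-dec_; map′; decidable-stable)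
open import Relation.Unary using (Decidable)

-- Counting and extremal elements in finite lists.

private variable
  A B : Set
  P : A → Set

-- Pigeonhole by deletion: the head of `xs` is cut out of `ys`, and the tail, which does not contain
-- it, still lies in what remains. Most of the counting below reduces to this.
length-mono : {xs ys : List A} → Unique xs → (∀ {z} → z ∈ xs → z ∈ ys) → length xs ≤ length ys
length-mono [] _ = z≤n
length-mono {xs = x ∷ xs} (x∉ ∷ u) xs⊆ys with ∈-∃++ (xs⊆ys (here refl))
... | as , bs , refl = begin
  suc (length xs)             ≤⟨ s≤s (length-mono u xs⊆) ⟩
  suc (length (as ++ bs))     ≡⟨ cong suc (length-++ as) ⟩
  suc (length as + length bs) ≡⟨ ≡-sym (+-suc (length as) _) ⟩
  length as + suc (length bs) ≡⟨ ≡-sym (length-++ as) ⟩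
  length (as ++ x ∷ bs)       ∎
  where
  open ≤-Reasoning
  xs⊆ : ∀ {z} → z ∈ xs → z ∈ as ++ bs
  xs⊆ z∈ with ∈-++⁻ as (xs⊆ys (there z∈))
  ... | inj₁ p           = ∈-++⁺ˡ p
  ... | inj₂ (here refl) = contradiction refl (All.lookup x∉ z∈)
  ... | inj₂ (there p)   = ∈-++⁺ʳ as p

unique-map : (f : A → B) {xs : List A} → Unique xs →
             (∀ {a b} → a ∈ xs → b ∈ xs → f a ≡ f b → a ≡ b) → Unique (map f xs)
unique-map f [] _ = []
unique-map f {x ∷ xs} (x∉ ∷ u) inj =
  All.tabulate fresh ∷ unique-map f u (λ p q → inj (there p) (there q))
  where
  fresh : ∀ {z} → z ∈ map f xs → f x ≢ z
  fresh z∈ eq with ∈-map⁻ f z∈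
  ... | b , b∈ , refl = All.lookup x∉ b∈ (inj (here refl) (there b∈) eq)

some? : Decidable P → (xs : List A) → (∃[ x ] (x ∈ xs × P x)) ⊎ (∀ {x} → x ∈ xs → ¬ P x)
some? P? xs with any? P? xs
... | yes p = inj₁ (find p)
... | no ¬p = inj₂ λ x∈ px → ¬p (lose x∈ px)

max-by : (f : A → ℕ) {x : A} {xs : List A} → x ∈ xs → ∃[ m ] (m ∈ xs × (∀ {y} → y ∈ xs → f y ≤ f m))
max-by f {x} {xs} x∈ = argmax f x xs , member , λ y∈ → All.lookup (f[xs]≤f[argmax] {f = f} x xs) y∈
  where
  member : argmax f x xs ∈ xs
  member with argmax-sel f x xs
  ... | inj₁ eq = subst (_∈ xs) (≡-sym eq) x∈
  ... | inj₂ p  = p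

min-by : (f : A → ℕ) {x : A} {xs : List A} → x ∈ xs → ∃[ m ] (m ∈ xs × (∀ {y} → y ∈ xs → f m ≤ f y))
min-by f {x} {xs} x∈ = argmin f x xs , member , λ y∈ → All.lookup (f[argmin]≤f[xs] {f = f} x xs) y∈
  where
  member : argmin f x xs ∈ xs
  member with argmin-sel f x xs
  ... | inj₁ eq = subst (_∈ xs) (≡-sym eq) x∈
  ... | inj₂ p  = p

module _ {A : Set} {P : A → Set} (P? : Decidable P) where

  filter-mono : {Q : A → Set} (Q? : Decidable Q) {xs ys : List A} → Unique xs →
                (∀ {x} → x ∈ xs → P x → x ∈ ys × Q x) →
                length (filter P? xs) ≤ length (filter Q? ys)
  filter-mono Q? {xs} u sub = length-mono (Uniqueₚ.filter⁺ P? u) λ z∈ →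
    let z∈xs , pz = ∈-filter⁻ P? {xs = xs} z∈
        z∈ys , qz = sub z∈xs pz
    in ∈-filter⁺ Q? z∈ys qz

  filter-mono-< : {Q : A → Set} (Q? : Decidable Q) {xs ys : List A} → Unique xs →
                  (∀ {x} → x ∈ xs → P x → x ∈ ys × Q x) →
                  ∀ {w} → w ∈ ys → Q w → (w ∈ xs → ¬ P w) →
                  length (filter P? xs) < length (filter Q? ys)
  filter-mono-< Q? {xs} {ys} u sub {w} w∈ qw w∉ =
    length-mono {xs = w ∷ filter P? xs} (All.tabulate fresh ∷ Uniqueₚ.filter⁺ P? u) λ
      { (here refl) → ∈-filter⁺ Q? w∈ qw
      ; (there z∈) → let z∈xs , pz = ∈-filter⁻ P? {xs = xs} z∈
                         z∈ys , qz = sub z∈xs pz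
                     in ∈-filter⁺ Q? z∈ys qz }
    where
    fresh : ∀ {z} → z ∈ filter P? xs → w ≢ z
    fresh z∈ refl = let z∈xs , pz = ∈-filter⁻ P? {xs = xs} z∈ in w∉ z∈xs pz

  length-filter-split : (xs : List A) →
    length (filter P? xs) + length (filter (¬? ∘ P?) xs) ≡ length xs
  length-filter-split [] = refl
  length-filter-split (x ∷ xs) with P? x
  ... | yes _ = cong suc (length-filter-split xs)
  ... | no _  = trans (+-suc _ _) (cong suc (length-filter-split xs))

  length-filter-delete : {xs : List A} → ∀ {x} → x ∈ xs → ¬ P x → length (filter P? xs) < length xs
  length-filter-delete {xs = xs} x∈ ¬px = filter-notAll P? xs (lose x∈ ¬px)

length-filter-⊎ : {A : Set} {P Q : A → Set} (P? : Decidable P) (Q? : Decidable Q) (xs : List A) →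
  length (filter (λ x → P? x ⊎-dec Q? x) xs) ≤ length (filter P? xs) + length (filter Q? xs)
length-filter-⊎ P? Q? [] = z≤n
length-filter-⊎ P? Q? (x ∷ xs) with P? x | Q? x
... | yes _ | yes _ = s≤s (≤-trans (length-filter-⊎ P? Q? xs) (+-monoʳ-≤ _ (n≤1+n _)))
... | yes _ | no _  = s≤s (length-filter-⊎ P? Q? xs)
... | no _  | yes _ = ≤-trans (s≤s (length-filter-⊎ P? Q? xs)) (≤-reflexive (≡-sym (+-suc _ _)))
... | no _  | no _  = length-filter-⊎ P? Q? xs

missing : (m : ℕ) (xs : List ℕ) → length xs < m → ∃[ a ] (a < m × a ∉ xs)
missing m xs short with some? (λ a → ¬? (any? (a ℕₚ.≟_) xs)) (upTo m)
... | inj₁ (a , a∈ , a∉) = a , ∈-upTo⁻ a∈ , a∉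
... | inj₂ all = contradiction short (≤⇒≯ (subst (_≤ length xs) (length-upTo m)
      (length-mono (Uniqueₚ.upTo⁺ m) λ {a} a∈ → decidable-stable (any? (a ℕₚ.≟_) xs) (all a∈))))

-- Galvin's kernel argument for bipartite graphs.

-- A bipartite graph is given by its edges E and by their ends x and y on the two sides; V
-- indexes both sides, so x e ≡ y f does not make e and f adjacent.
module Bipartite {E V : Set} (_≟_ : DecidableEquality E) (_≟ᵥ_ : DecidableEquality V) (x y : E → V) where

  infixl 6 _∖_
  _∖_ : List E → E → List E
  H ∖ e = filter (λ f → ¬? (f ≟ e)) H

  ∈-∖ : ∀ {H e f} → f ∈ H → f ≢ e → f ∈ H ∖ e
  ∈-∖ {e = e} = ∈-filter⁺ (λ f → ¬? (f ≟ e))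

  ∖-∈ : ∀ {H e f} → f ∈ H ∖ e → f ∈ H × f ≢ e
  ∖-∈ {e = e} = ∈-filter⁻ (λ f → ¬? (f ≟ e))

  Adjacent : E → E → Set
  Adjacent e f = x e ≡ x f ⊎ y e ≡ y f

  Proper : (E → ℕ) → List E → Set
  Proper c H = ∀ {e f} → e ∈ H → f ∈ H → e ≢ f → Adjacent e f → c e ≢ c f

  module Galvin (c : E → ℕ) where

    -- The edge f is preferred to e at a common end: large colours first on the x-side, small
    -- colours first on the y-side.
    _▷_ : E → E → Set
    f ▷ e = (x f ≡ x e × c e < c f) ⊎ (y f ≡ y e × c f < c e)

    preferred? : ∀ e → Decidable (_▷ e)
    preferred? e f = ((x f ≟ᵥ x e) ×-dec (c e <? c f)) ⊎-dec ((y f ≟ᵥ y e) ×-dec (c f <? c e))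

    -- A kernel of the digraph on `S` with an arc from each edge to every edge preferred to it;
    -- equivalently, a stable matching for the preferences `▷`.
    record Kernel (S : List E) : Set where
      field
        K           : List E
        K⊆S         : ∀ {e} → e ∈ K → e ∈ S
        independent : ∀ {e f} → e ∈ K → f ∈ K → e ≢ f → ¬ Adjacent e f
        absorbing   : ∀ {e} → e ∈ S → e ∈ K ⊎ ∃[ f ] (f ∈ K × f ▷ e)

    -- The Gale-Shapley argument as an induction on the size of `S`: every x-end proposes its edge
    -- of largest colour. Proposals that do not clash at the y-ends form a kernel; if two clash, the
    -- rejected one is deleted from `S`.
    kernel : ∀ m S → length S ≤ m → Proper c S → Kernel S
    kernel zero [] _ _ = record
      { K = [] ; K⊆S = id ; independent = λ () ; absorbing = λ () }
    kernel (suc m) S bound proper = go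
      where
      Top : E → Set
      Top e = ∀ {f} → f ∈ S → ¬ (x f ≡ x e × c e < c f)

      top? : Decidable Top
      top? e with some? (λ f → (x f ≟ᵥ x e) ×-dec (c e <? c f)) S
      ... | inj₁ (f , f∈ , p) = no λ top → top f∈ p
      ... | inj₂ none         = yes none

      tops : List E
      tops = filter top? S

      tops-x : ∀ {e f} → e ∈ tops → f ∈ tops → x e ≡ x f → e ≡ f
      tops-x {e} {f} e∈ f∈ eq with ∈-filter⁻ top? {xs = S} e∈ | ∈-filter⁻ top? {xs = S} f∈ | e ≟ f
      ... | _        | _        | yes e≡f = e≡f
      ... | e∈S , te | f∈S , tf | no e≢f with <-cmp (c e) (c f)
      ...   | tri< lt _ _ = contradiction (≡-sym eq , lt) (te f∈S)
      ...   | tri≈ _ ce _ = contradiction ce (proper e∈S f∈S e≢f (inj₁ eq))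
      ...   | tri> _ _ gt = contradiction (eq , gt) (tf e∈S)

      below-top : ∀ {e} → e ∈ S → e ∈ tops ⊎ ∃[ f ] (f ∈ tops × f ▷ e)
      below-top {e} e∈ with top? e
      ... | yes te = inj₁ (∈-filter⁺ top? e∈ te)
      ... | no ¬te with some? (λ f → (x f ≟ᵥ x e) ×-dec (c e <? c f)) S
      ...   | inj₂ none = contradiction (λ {f} → none {f}) ¬te
      -- The edge `f` that beats `e` need not be a top itself, but the edge of largest colour at the
      -- same x-end is one.
      ...   | inj₁ (f , f∈ , xf , lt) with max-by c (∈-filter⁺ (λ g → x g ≟ᵥ x e) f∈ xf)
      ...     | g , g∈′ , best with ∈-filter⁻ (λ g → x g ≟ᵥ x e) {xs = S} g∈′
      ...       | g∈ , xg = inj₂ (g , ∈-filter⁺ top? g∈ tg , inj₁ (xg , <-≤-trans lt (best (∈-filter⁺ _ f∈ xf))))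
        where
        tg : Top g
        tg h∈ (xh , lt′) = <⇒≱ lt′ (best (∈-filter⁺ _ h∈ (trans xh xg)))

      Clash : E → E → Set
      Clash e f = y e ≡ y f × c e < c f

      clash? : ∀ e → Decidable (Clash e)
      clash? e f = (y e ≟ᵥ y f) ×-dec (c e <? c f)

      clashing? : Decidable (λ e → Any (Clash e) tops)
      clashing? e = any? (clash? e) tops

      go : Kernel S
      go with some? clashing? tops
      ... | inj₂ none = record
        { K           = tops
        ; K⊆S         = λ e∈ → proj₁ (∈-filter⁻ top? e∈)
        ; independent = λ { e∈ f∈ e≢f (inj₁ eq) → e≢f (tops-x e∈ f∈ eq)
                          ; e∈ f∈ e≢f (inj₂ eq) → indep-y e∈ f∈ e≢f eq }
        ; absorbing   = below-top }
        where
        indep-y : ∀ {e f} → e ∈ tops → f ∈ tops → e ≢ f → y e ≢ y f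
        indep-y {e} {f} e∈ f∈ e≢f eq with <-cmp (c e) (c f)
        ... | tri< lt _ _ = none e∈ (lose f∈ (eq , lt))
        ... | tri> _ _ gt = none f∈ (lose e∈ (≡-sym eq , gt))
        ... | tri≈ _ ce _ = proper (proj₁ (∈-filter⁻ top? e∈)) (proj₁ (∈-filter⁻ top? f∈)) e≢f (inj₂ eq) ce
      -- Two tops e, f clash at a common y-end; the worse one, f, can be left out, because
      -- whatever excludes e from the kernel of the rest must beat e at y, hence also beats f.
      ... | inj₁ (e , e∈ , clash) with find clash
      ...   | f , f∈ , ye≡yf , lt = record
        { K           = Kernel.K rest
        ; K⊆S         = λ g∈ → proj₁ (∖-∈ (Kernel.K⊆S rest g∈))
        ; independent = Kernel.independent rest
        ; absorbing   = absorb }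
        where
        e∈S = proj₁ (∈-filter⁻ top? {xs = S} e∈)
        f∈S = proj₁ (∈-filter⁻ top? {xs = S} f∈)

        rest : Kernel (S ∖ f)
        rest = kernel m (S ∖ f)
          (s≤s⁻¹ (≤-trans (length-filter-delete _ f∈S λ f≢f → f≢f refl) bound))
          (λ g∈ h∈ → proper (proj₁ (∖-∈ g∈)) (proj₁ (∖-∈ h∈)))

        f-absorbed : ∃[ g ] (g ∈ Kernel.K rest × g ▷ f)
        f-absorbed with Kernel.absorbing rest (∈-∖ e∈S λ { refl → <-irrefl refl lt })
        ... | inj₁ e∈K = e , e∈K , inj₂ (ye≡yf , lt)
        ... | inj₂ (g , g∈ , inj₁ better) =
          contradiction better (proj₂ (∈-filter⁻ top? {xs = S} e∈) (proj₁ (∖-∈ (Kernel.K⊆S rest g∈))))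
        ... | inj₂ (g , g∈ , inj₂ (yg , lt′)) = g , g∈ , inj₂ (trans yg ye≡yf , <-trans lt′ lt)

        absorb : ∀ {g} → g ∈ S → g ∈ Kernel.K rest ⊎ ∃[ h ] (h ∈ Kernel.K rest × h ▷ g)
        absorb {g} g∈ with g ≟ f
        ... | yes refl = inj₂ f-absorbed
        ... | no g≢f   = Kernel.absorbing rest (∈-∖ g∈ g≢f)

    -- Pick a colour `a` from some list and give it to a kernel `K` of the edges whose lists contain
    -- `a`; then drop `a` from the other lists and recurse. The invariant, fewer preferred edges
    -- than colours, survives because an edge that loses `a` also loses a preferred edge.
    list-colouring : ∀ m H (L : E → List ℕ) → length H ≤ m → Unique H → Proper c H →
      (∀ {e} → e ∈ H → Unique (L e) × length (filter (preferred? e) H) < length (L e)) →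
      Σ[ γ ∈ (E → ℕ) ] ((∀ {e} → e ∈ H → γ e ∈ L e) × Proper γ H)
    list-colouring _ [] _ _ _ _ _ = (λ _ → 0) , (λ ()) , λ ()
    list-colouring (suc m) H@(e₀ ∷ _) L bound uH proper long with L e₀ in eqL | long (here refl)
    ... | []    | _ , ()
    ... | a ∷ _ | _ = γ′ , γ′∈L , γ′-proper
      where
      S : List E
      S = filter (λ e → any? (a ℕₚ.≟_) (L e)) H

      S⊆H : ∀ {e} → e ∈ S → e ∈ H × a ∈ L e
      S⊆H = ∈-filter⁻ (λ e → any? (a ℕₚ.≟_) (L e))

      e₀∈S : e₀ ∈ S
      e₀∈S = ∈-filter⁺ (λ e → any? (a ℕₚ.≟_) (L e)) {xs = H} (here refl) (subst (a ∈_) (≡-sym eqL) (here refl))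

      kernel-S : Kernel S
      kernel-S = kernel (length S) S ≤-refl λ e∈ f∈ → proper (proj₁ (S⊆H e∈)) (proj₁ (S⊆H f∈))

      open Kernel kernel-S

      K? : Decidable (_∈ K)
      K? e = any? (e ≟_) K

      H′ : List E
      H′ = filter (¬? ∘ K?) H

      H′⊆H : ∀ {e} → e ∈ H′ → e ∈ H × e ∉ K
      H′⊆H = ∈-filter⁻ (¬? ∘ K?)

      uH′ : Unique H′
      uH′ = Uniqueₚ.filter⁺ (¬? ∘ K?) uH

      K-nonempty : ∃[ f ] (f ∈ K)
      K-nonempty with absorbing e₀∈S
      ... | inj₁ e₀∈K         = e₀ , e₀∈K
      ... | inj₂ (f , f∈ , _) = f , f∈

      L′ : E → List ℕ
      L′ e = filter (λ b → ¬? (b ℕₚ.≟ a)) (L e)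

      long′ : ∀ {e} → e ∈ H′ → Unique (L′ e) × length (filter (preferred? e) H′) < length (L′ e)
      long′ {e} e∈ with H′⊆H e∈
      ... | e∈H , e∉K with long e∈H | any? (a ℕₚ.≟_) (L e)
      ...   | uL , len | no a∉ = Uniqueₚ.filter⁺ _ uL ,
              ≤-<-trans (filter-mono (preferred? e) (preferred? e) uH′ λ f∈ p → proj₁ (H′⊆H f∈) , p)
                (subst (length (filter (preferred? e) H) <_)
                   (≡-sym (cong length (filter-all (λ b → ¬? (b ℕₚ.≟ a))
                      (All.tabulate λ {b} b∈ b≡a → a∉ (subst (_∈ L e) b≡a b∈)))))
                   len)
      ...   | uL , len | yes a∈ with absorbing (∈-filter⁺ (λ e → any? (a ℕₚ.≟_) (L e)) e∈H a∈)
      ...     | inj₁ e∈K = contradiction e∈K e∉K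
      -- The list of `e` loses only `a`, while `f`, preferred to `e`, is no longer in `H′`; the
      -- count drops by at least as much as the length.
      ...     | inj₂ (f , f∈K , f▷e) = Uniqueₚ.filter⁺ _ uL ,
                <-≤-trans (filter-mono-< (preferred? e) (preferred? e) uH′
                             (λ g∈ p → proj₁ (H′⊆H g∈) , p) (proj₁ (S⊆H (K⊆S f∈K))) f▷e
                             (λ f∈H′ _ → proj₂ (H′⊆H f∈H′) f∈K))
                  (s≤s⁻¹ (≤-trans len longL))
        where
        longL : length (L e) ≤ suc (length (L′ e))
        longL = length-mono {ys = a ∷ L′ e} uL λ {b} b∈ → case b ℕₚ.≟ a of λ
          { (yes refl) → here refl
          ; (no b≢a)   → there (∈-filter⁺ (λ b → ¬? (b ℕₚ.≟ a)) b∈ b≢a) }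

      rec = list-colouring m H′ L′
        (s≤s⁻¹ (≤-trans (length-filter-delete (¬? ∘ K?) (proj₁ (S⊆H (K⊆S (proj₂ K-nonempty))))
                           λ ∉K → ∉K (proj₂ K-nonempty)) bound))
        uH′
        (λ e∈ f∈ → proper (proj₁ (H′⊆H e∈)) (proj₁ (H′⊆H f∈)))
        long′
      γ = proj₁ rec

      γ∈ : ∀ {e} → e ∈ H → e ∉ K → γ e ∈ L e × γ e ≢ a
      γ∈ e∈ e∉ = ∈-filter⁻ (λ b → ¬? (b ℕₚ.≟ a)) (proj₁ (proj₂ rec) (∈-filter⁺ (¬? ∘ K?) e∈ e∉))

      γ′ : E → ℕ
      γ′ e with K? e
      ... | yes _ = a
      ... | no _  = γ e

      γ′∈L : ∀ {e} → e ∈ H → γ′ e ∈ L e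
      γ′∈L {e} e∈ with K? e
      ... | yes e∈K = proj₂ (S⊆H (K⊆S e∈K))
      ... | no e∉K  = proj₁ (γ∈ e∈ e∉K)

      γ′-proper : Proper γ′ H
      γ′-proper {e} {f} e∈ f∈ e≢f adj with K? e | K? f
      ... | yes e∈K | yes f∈K = contradiction adj (independent e∈K f∈K e≢f)
      ... | yes _   | no f∉K  = proj₂ (γ∈ f∈ f∉K) ∘ ≡-sym
      ... | no e∉K  | yes _   = proj₂ (γ∈ e∈ e∉K)
      ... | no e∉K  | no f∉K  =
        proj₂ (proj₂ rec) (∈-filter⁺ (¬? ∘ K?) e∈ e∉K) (∈-filter⁺ (¬? ∘ K?) f∈ f∉K) e≢f adj

-- Kempe chains and König's edge-colouring theorem.

-- Saturation: candidates in `Q` move to `K` as long as one of them has a reason to. Each member of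
-- `K` keeps its reason, which is what allows a Kempe chain to be traced backwards.
closure : {E : Set} → DecidableEquality E → {I : E → Set} → Decidable I →
  {R : E → E → Set} → (∀ e → Decidable (R e)) → (H : List E) →
  Σ[ K ∈ List E ] ((∀ {f} → f ∈ K → f ∈ H × (I f ⊎ ∃[ e ] (e ∈ K × R e f))) ×
                   (∀ {f} → f ∈ H → I f → f ∈ K) ×
                   (∀ {e f} → e ∈ K → f ∈ H → R e f → f ∈ K))
closure {E} _≟_ {I} I? {R} R? H = saturate (length H) H [] ≤-refl id inj₁ λ ()
  where
  Justified : List E → E → Set
  Justified K f = I f ⊎ ∃[ e ] (e ∈ K × R e f)

  saturate : ∀ m Q K → length Q ≤ m → (∀ {f} → f ∈ Q → f ∈ H) → (∀ {f} → f ∈ H → f ∈ Q ⊎ f ∈ K) →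
    (∀ {f} → f ∈ K → f ∈ H × Justified K f) →
    Σ[ K ∈ List E ] ((∀ {f} → f ∈ K → f ∈ H × Justified K f) ×
                     (∀ {f} → f ∈ H → I f → f ∈ K) ×
                     (∀ {e f} → e ∈ K → f ∈ H → R e f → f ∈ K))
  saturate m Q K bound Q⊆H cover just with some? (λ f → I? f ⊎-dec any? (λ e → R? e f) K) Q
  ... | inj₂ none = K , just ,
        (λ f∈ i → [ (λ f∈Q → contradiction (inj₁ i) (none f∈Q)) , id ]′ (cover f∈)) ,
        (λ e∈ f∈ r → [ (λ f∈Q → contradiction (inj₂ (lose e∈ r)) (none f∈Q)) , id ]′ (cover f∈))
  saturate zero [] K bound Q⊆H cover just | inj₁ (f , () , _)
  saturate (suc m) Q K bound Q⊆H cover just | inj₁ (f , f∈ , reason) =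
    saturate m (filter other? Q) (f ∷ K)
      (s≤s⁻¹ (≤-trans (length-filter-delete other? f∈ λ f≢f → f≢f refl) bound))
      (λ g∈ → Q⊆H (proj₁ (∈-filter⁻ other? g∈)))
      cover′ just′
    where
    other? : Decidable (_≢ f)
    other? g = ¬? (g ≟ f)

    cover′ : ∀ {g} → g ∈ H → g ∈ filter other? Q ⊎ g ∈ f ∷ K
    cover′ {g} g∈ with cover g∈ | g ≟ f
    ... | _        | yes refl = inj₂ (here refl)
    ... | inj₁ g∈Q | no g≢f   = inj₁ (∈-filter⁺ other? g∈Q g≢f)
    ... | inj₂ g∈K | no _     = inj₂ (there g∈K)

    widen : ∀ {g} → Justified K g → Justified (f ∷ K) g
    widen (inj₁ i)            = inj₁ i
    widen (inj₂ (e , e∈ , r)) = inj₂ (e , there e∈ , r)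

    just′ : ∀ {g} → g ∈ f ∷ K → g ∈ H × Justified (f ∷ K) g
    just′ (here refl) = Q⊆H f∈ , widen ([ inj₁ , inj₂ ∘ find ]′ reason)
    just′ (there g∈)  = let g∈H , j = just g∈ in g∈H , widen j

module König {E V : Set} (_≟_ : DecidableEquality E) (_≟ᵥ_ : DecidableEquality V) (x y : E → V) where

  open Bipartite _≟_ _≟ᵥ_ x y

  Missing : (E → ℕ) → List E → (E → V) → V → ℕ → Set
  Missing c H end v a = ∀ {f} → f ∈ H → end f ≡ v → c f ≢ a

  -- The Kempe chain K through v swaps a and b. It does not reach w, because a chain
  -- arriving at the x-side does so along an edge of colour a.
  kempe : ∀ {c H a b v w} → a ≢ b → Proper c H → Missing c H y v b → Missing c H x w a →
    Σ[ c′ ∈ (E → ℕ) ] (Proper c′ H × Missing c′ H y v a × Missing c′ H x w a ×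
                       (∀ f → c′ f ≡ c f ⊎ c′ f ≡ a ⊎ c′ f ≡ b))
  kempe {c} {H} {a} {b} {v} {w} a≢b proper no-b no-a
    -- The chain is oriented: it starts with colour `a` at `v`, passes from `a` to `b` across x-ends
    -- and from `b` to `a` across y-ends.
    with closure _≟_ {λ f → y f ≡ v × c f ≡ a} (λ f → (y f ≟ᵥ v) ×-dec (c f ℕₚ.≟ a))
           {λ e f → (c e ≡ a × c f ≡ b × x e ≡ x f) ⊎ (c e ≡ b × c f ≡ a × y e ≡ y f)}
           (λ e f → ((c e ℕₚ.≟ a) ×-dec (c f ℕₚ.≟ b) ×-dec (x e ≟ᵥ x f))
              ⊎-dec ((c e ℕₚ.≟ b) ×-dec (c f ℕₚ.≟ a) ×-dec (y e ≟ᵥ y f))) H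
  ... | K , just , start , next = c′ , c′-proper , missing-v , missing-w , palette
    where
    colour-a∨b : ∀ {f} → f ∈ K → c f ≡ a ⊎ c f ≡ b
    colour-a∨b f∈ with just f∈
    ... | _ , inj₁ (_ , cf)                    = inj₁ cf
    ... | _ , inj₂ (_ , _ , inj₁ (_ , cf , _)) = inj₂ cf
    ... | _ , inj₂ (_ , _ , inj₂ (_ , cf , _)) = inj₁ cf

    before-a : ∀ {f} → f ∈ K → c f ≡ a → y f ≡ v ⊎ ∃[ g ] (g ∈ K × c g ≡ b × y g ≡ y f)
    before-a f∈ cf with just f∈
    ... | _ , inj₁ (yf , _)                         = inj₁ yf
    ... | _ , inj₂ (_ , _ , inj₁ (_ , cf′ , _))     = contradiction (trans (≡-sym cf) cf′) a≢b
    ... | _ , inj₂ (g , g∈ , inj₂ (cg , _ , yg≡yf)) = inj₂ (g , g∈ , cg , yg≡yf)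

    before-b : ∀ {f} → f ∈ K → c f ≡ b → ∃[ g ] (g ∈ K × c g ≡ a × x g ≡ x f)
    before-b f∈ cf with just f∈
    ... | _ , inj₁ (_ , cf′)                        = contradiction (trans (≡-sym cf′) cf) a≢b
    ... | _ , inj₂ (_ , _ , inj₂ (_ , cf′ , _))     = contradiction (trans (≡-sym cf′) cf) a≢b
    ... | _ , inj₂ (g , g∈ , inj₁ (cg , _ , xg≡xf)) = g , g∈ , cg , xg≡xf

    same : ∀ {e f} → e ∈ H → f ∈ H → Adjacent e f → c e ≡ c f → e ≡ f
    same {e} {f} e∈ f∈ adj eq = decidable-stable (e ≟ f) λ e≢f → proper e∈ f∈ e≢f adj eq

    K⊆H : ∀ {f} → f ∈ K → f ∈ H
    K⊆H f∈ = proj₁ (just f∈)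

    -- Only applied on `K`, where `a` and `b` are the only colours, so the value at other colours is
    -- immaterial.
    swap : ℕ → ℕ
    swap d with d ℕₚ.≟ a
    ... | yes _ = b
    ... | no _  = a

    swap-a : ∀ {d} → d ≡ a → swap d ≡ b
    swap-a {d} eq with d ℕₚ.≟ a
    ... | yes _ = refl
    ... | no ¬p = contradiction eq ¬p

    swap-b : ∀ {d} → d ≡ b → swap d ≡ a
    swap-b {d} eq with d ℕₚ.≟ a
    ... | yes p = trans (≡-sym eq) p
    ... | no _  = refl

    swap≡a⇒b : ∀ {f} → f ∈ K → swap (c f) ≡ a → c f ≡ b
    swap≡a⇒b f∈ eq with colour-a∨b f∈
    ... | inj₂ cf = cf
    ... | inj₁ cf = contradiction (trans (≡-sym eq) (swap-a cf)) a≢b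

    in-K? : Decidable (_∈ K)
    in-K? f = any? (f ≟_) K

    c′ : E → ℕ
    c′ f with in-K? f
    ... | yes _ = swap (c f)
    ... | no _  = c f

    -- A conflict forces `f` to have the other colour of the pair. At the end where the chain leaves
    -- `e`, closure puts `f` into `K`. At the end where it arrives, `f` has the colour of the
    -- predecessor of `e` and so equals it; if `e` starts the chain, that end is `v`, where `b` is
    -- missing.
    boundary : ∀ {e f} → e ∈ K → f ∈ H → f ∉ K → Adjacent e f → swap (c e) ≢ c f
    boundary e∈ f∈ f∉ adj eq with colour-a∨b e∈
    boundary e∈ f∈ f∉ (inj₁ xe≡xf) eq | inj₁ ce =
      f∉ (next e∈ f∈ (inj₁ (ce , trans (≡-sym eq) (swap-a ce) , xe≡xf)))
    boundary e∈ f∈ f∉ (inj₂ ye≡yf) eq | inj₁ ce with before-a e∈ ce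
    ... | inj₁ ye≡v = no-b f∈ (trans (≡-sym ye≡yf) ye≡v) (trans (≡-sym eq) (swap-a ce))
    ... | inj₂ (g , g∈ , cg , yg≡ye) = f∉ (subst (_∈ K)
          (same (K⊆H g∈) f∈ (inj₂ (trans yg≡ye ye≡yf)) (trans cg (trans (≡-sym (swap-a ce)) eq))) g∈)
    boundary e∈ f∈ f∉ (inj₂ ye≡yf) eq | inj₂ ce =
      f∉ (next e∈ f∈ (inj₂ (ce , trans (≡-sym eq) (swap-b ce) , ye≡yf)))
    boundary e∈ f∈ f∉ (inj₁ xe≡xf) eq | inj₂ ce with before-b e∈ ce
    ... | g , g∈ , cg , xg≡xe = f∉ (subst (_∈ K)
          (same (K⊆H g∈) f∈ (inj₁ (trans xg≡xe xe≡xf)) (trans cg (trans (≡-sym (swap-b ce)) eq))) g∈)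

    c′-proper : Proper c′ H
    c′-proper {e} {f} e∈ f∈ e≢f adj with in-K? e | in-K? f
    ... | no _    | no _    = proper e∈ f∈ e≢f adj
    ... | yes e∈K | no f∉K  = boundary e∈K f∈ f∉K adj
    ... | no e∉K  | yes f∈K = boundary f∈K e∈ e∉K ([ inj₁ ∘ ≡-sym , inj₂ ∘ ≡-sym ]′ adj) ∘ ≡-sym
    ... | yes e∈K | yes f∈K with colour-a∨b e∈K | colour-a∨b f∈K
    ...   | inj₁ ce | inj₁ cf = λ _ → proper e∈ f∈ e≢f adj (trans ce (≡-sym cf))
    ...   | inj₂ ce | inj₂ cf = λ _ → proper e∈ f∈ e≢f adj (trans ce (≡-sym cf))
    ...   | inj₁ ce | inj₂ cf = λ eq → a≢b (trans (≡-sym (swap-b cf)) (trans (≡-sym eq) (swap-a ce)))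
    ...   | inj₂ ce | inj₁ cf = λ eq → a≢b (trans (≡-sym (swap-b ce)) (trans eq (swap-a cf)))

    missing-v : Missing c′ H y v a
    missing-v {f} f∈ yf with in-K? f
    ... | yes f∈K = λ eq → no-b f∈ yf (swap≡a⇒b f∈K eq)
    ... | no f∉K  = λ cf → f∉K (start f∈ (yf , cf))

    missing-w : Missing c′ H x w a
    missing-w {f} f∈ xf with in-K? f
    ... | no _    = no-a f∈ xf
    ... | yes f∈K = λ eq → let g , g∈ , cg , xg≡xf = before-b f∈K (swap≡a⇒b f∈K eq)
                           in no-a (K⊆H g∈) (trans xg≡xf xf) cg

    palette : ∀ f → c′ f ≡ c f ⊎ c′ f ≡ a ⊎ c′ f ≡ b
    palette f with in-K? f
    ... | no _ = inj₁ refl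
    ... | yes _ with c f ℕₚ.≟ a
    ...   | yes _ = inj₂ (inj₂ refl)
    ...   | no _  = inj₂ (inj₁ refl)

  degree-at : (E → V) → V → List E → ℕ
  degree-at end v H = length (filter (λ f → end f ≟ᵥ v) H)

  missing-colour : ∀ (c : E → ℕ) end v {H m} → degree-at end v H < m → ∃[ a ] (a < m × Missing c H end v a)
  missing-colour c end v {H} {m} small =
    let a , a<m , a∉ = missing m (map c (filter (λ f → end f ≟ᵥ v) H))
                         (subst (_< m) (≡-sym (length-map c (filter (λ f → end f ≟ᵥ v) H))) small)
    in a , a<m , λ f∈ ef eq → a∉ (subst (_∈ _) eq (∈-map⁺ c (∈-filter⁺ (λ f → end f ≟ᵥ v) f∈ ef)))

  -- Edges are added in order of decreasing D, so both colours of the Kempe chain used for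
  -- the new edge are admissible for all the earlier ones.
  proper-colouring : (D : V → ℕ) → ∀ m H → length H ≤ m → Unique H →
    (∀ {e} → e ∈ H → degree-at x (x e) H ≤ D (x e) × degree-at y (y e) H ≤ D (x e)) →
    Σ[ c ∈ (E → ℕ) ] (Proper c H × (∀ {e} → e ∈ H → c e < D (x e)))
  proper-colouring D _ [] _ _ _ = (λ _ → 0) , (λ ()) , λ ()
  proper-colouring D (suc m) H@(_ ∷ _) bound uH deg with min-by (λ f → D (x f)) {xs = H} (here refl)
  ... | e , e∈ , least
    with proper-colouring D m (H ∖ e)
      (s≤s⁻¹ (≤-trans (length-filter-delete (λ f → ¬? (f ≟ e)) e∈ λ e≢e → e≢e refl) bound))
      (Uniqueₚ.filter⁺ (λ f → ¬? (f ≟ e)) uH)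
      (λ {f} f∈ → let dx , dy = deg (proj₁ (∖-∈ f∈))
                  in ≤-trans (smaller e x (x f)) dx , ≤-trans (smaller e y (y f)) dy)
    where
    smaller : ∀ e end v → degree-at end v (H ∖ e) ≤ degree-at end v H
    smaller e end v = filter-mono (λ f → end f ≟ᵥ v) (λ f → end f ≟ᵥ v)
      (Uniqueₚ.filter⁺ (λ f → ¬? (f ≟ e)) uH) λ f∈ p → proj₁ (∖-∈ f∈) , p
  ...   | c , proper , small = extended
    where
    d = D (x e)

    below : ∀ end → degree-at end (end e) (H ∖ e) < degree-at end (end e) H
    below end = filter-mono-< (λ f → end f ≟ᵥ end e) (λ f → end f ≟ᵥ end e)
      (Uniqueₚ.filter⁺ (λ f → ¬? (f ≟ e)) uH) (λ f∈ p → proj₁ (∖-∈ f∈) , p) e∈ refl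
      λ e∈′ _ → proj₂ (∖-∈ {H} e∈′) refl

    d≤ : ∀ {f} → f ∈ H ∖ e → d ≤ D (x f)
    d≤ f∈ = least (proj₁ (∖-∈ f∈))

    Goal = Σ[ c ∈ (E → ℕ) ] (Proper c H × (∀ {e} → e ∈ H → c e < D (x e)))

    extend : ∀ {a} (c : E → ℕ) → Proper c (H ∖ e) → (∀ {f} → f ∈ H ∖ e → c f < D (x f)) → a < d →
             Missing c (H ∖ e) x (x e) a → Missing c (H ∖ e) y (y e) a → Goal
    extend {a} c proper small a<d mx my = c⁺ , c⁺-proper , c⁺-small
      where
      c⁺ : E → ℕ
      c⁺ f with f ≟ e
      ... | yes _ = a
      ... | no _  = c f

      c⁺-proper : Proper c⁺ H
      c⁺-proper {f} {g} f∈ g∈ f≢g adj with f ≟ e | g ≟ e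
      ... | yes refl | yes refl = contradiction refl f≢g
      ... | no f≢e   | no g≢e   = proper (∈-∖ f∈ f≢e) (∈-∖ g∈ g≢e) f≢g adj
      ... | yes refl | no g≢e   = [ mx (∈-∖ g∈ g≢e) ∘ ≡-sym , my (∈-∖ g∈ g≢e) ∘ ≡-sym ]′ adj ∘ ≡-sym
      ... | no f≢e   | yes refl = [ mx (∈-∖ f∈ f≢e) , my (∈-∖ f∈ f≢e) ]′ adj

      c⁺-small : ∀ {f} → f ∈ H → c⁺ f < D (x f)
      c⁺-small {f} f∈ with f ≟ e
      ... | yes refl = a<d
      ... | no f≢e   = small (∈-∖ f∈ f≢e)

    extended : Goal
    -- Once `e` is removed, both of its ends have degree below `d`, so each misses a colour below
    -- `d`.
    extended with missing-colour c x (x e) (<-≤-trans (below x) (proj₁ (deg e∈)))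
                | missing-colour c y (y e) (<-≤-trans (below y) (proj₂ (deg e∈)))
    ... | a , a<d , mx | b , b<d , my with a ℕₚ.≟ b
    ...   | yes refl = extend c proper small a<d mx my
    -- The swap frees `a` at the y-end and keeps it free at the x-end, so `e` can take `a`.
    ...   | no a≢b with kempe a≢b proper my mx
    ...     | c′ , proper′ , my′ , mx′ , palette = extend c′ proper′ small′ a<d mx′ my′
      where
      small′ : ∀ {f} → f ∈ H ∖ e → c′ f < D (x f)
      small′ {f} f∈ with palette f
      ... | inj₁ eq        = subst (_< D (x f)) (≡-sym eq) (small f∈)
      ... | inj₂ (inj₁ eq) = subst (_< D (x f)) (≡-sym eq) (<-≤-trans a<d (d≤ f∈))
      ... | inj₂ (inj₂ eq) = subst (_< D (x f)) (≡-sym eq) (<-≤-trans b<d (d≤ f∈))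

-- The theorem of Borodin, Kostochka and Woodall.

module BipartiteListColouring {E V : Set} (_≟_ : DecidableEquality E) (_≟ᵥ_ : DecidableEquality V)
  (x y : E → V) where

  open Bipartite _≟_ _≟ᵥ_ x y
  open König _≟_ _≟ᵥ_ x y

  -- A König colouring with `c e < D (x e)` leaves fewer than `D (x e)` edges preferred to `e`, so
  -- Galvin's induction applies. This is the case of the theorem in which the list sizes are
  -- governed by the x-ends.
  bipartite-list-colouring : (D : V → ℕ) (L : E → List ℕ) → ∀ {H} → Unique H →
    (∀ {e} → e ∈ H → degree-at x (x e) H ≤ D (x e) × degree-at y (y e) H ≤ D (x e)) →
    (∀ {e} → e ∈ H → Unique (L e) × D (x e) ≤ length (L e)) →
    Σ[ γ ∈ (E → ℕ) ] ((∀ {e} → e ∈ H → γ e ∈ L e) × Proper γ H)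
  bipartite-list-colouring D L {H} uH deg long with proper-colouring D (length H) H ≤-refl uH deg
  ... | c , proper , small = list-colouring (length H) H L ≤-refl uH proper λ e∈ →
        proj₁ (long e∈) , <-≤-trans (few e∈) (proj₂ (long e∈))
    where
    open Galvin c

    -- The colours of the edges preferred to e are distinct, since those at x e exceed c e and
    -- those at y e are smaller than c e.
    few : ∀ {e} → e ∈ H → length (filter (preferred? e) H) < D (x e)
    few {e} e∈ = subst₂ _<_ (length-map c pref) (length-upTo (D (x e)))
      (length-mono {xs = c e ∷ map c pref} (All.tabulate fresh ∷ distinct) λ
        { (here refl) → ∈-upTo⁺ (small e∈)
        ; (there z∈)  → in-range z∈ })
      where
      pref = filter (preferred? e) H

      pref⁻ : ∀ {f} → f ∈ pref → f ∈ H × f ▷ e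
      pref⁻ = ∈-filter⁻ (preferred? e)

      fresh : ∀ {z} → z ∈ map c pref → c e ≢ z
      fresh z∈ eq with ∈-map⁻ c z∈
      ... | f , f∈ , z≡ with pref⁻ f∈
      ...   | _ , inj₁ (_ , lt) = <-irrefl (trans eq z≡) lt
      ...   | _ , inj₂ (_ , lt) = <-irrefl (≡-sym (trans eq z≡)) lt

      in-range : ∀ {z} → z ∈ map c pref → z ∈ upTo (D (x e))
      in-range z∈ with ∈-map⁻ c z∈
      ... | f , f∈ , refl with pref⁻ f∈
      -- An edge preferred at the x-end obeys the same bound `D (x e)`; one preferred at the y-end
      -- may have another bound, but its colour is below `c e`.
      ...   | f∈H , inj₁ (xf , _) = ∈-upTo⁺ (subst (λ v → c f < D v) xf (small f∈H))
      ...   | f∈H , inj₂ (_ , lt) = ∈-upTo⁺ (<-trans lt (small e∈))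

      injective : ∀ {f g} → f ∈ pref → g ∈ pref → c f ≡ c g → f ≡ g
      injective {f} {g} f∈ g∈ eq with pref⁻ f∈ | pref⁻ g∈ | f ≟ g
      ... | _ | _ | yes f≡g = f≡g
      ... | f∈H , inj₁ (xf , _) | g∈H , inj₁ (xg , _) | no f≢g =
            contradiction eq (proper f∈H g∈H f≢g (inj₁ (trans xf (≡-sym xg))))
      ... | f∈H , inj₂ (yf , _) | g∈H , inj₂ (yg , _) | no f≢g =
            contradiction eq (proper f∈H g∈H f≢g (inj₂ (trans yf (≡-sym yg))))
      ... | _ , inj₁ (_ , lt) | _ , inj₂ (_ , lt′) | no _ = contradiction eq (>⇒≢ (<-trans lt′ lt))
      ... | _ , inj₂ (_ , lt) | _ , inj₁ (_ , lt′) | no _ = contradiction eq (<⇒≢ (<-trans lt lt′))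

      distinct : Unique (map c pref)
      distinct = unique-map c (Uniqueₚ.filter⁺ (preferred? e) uH) injective

-- Peeling off vertices with few neighbours.

-- The sum 0 + 1 + ... + (j - 1), that is, j(j - 1)/2.
triangle : ℕ → ℕ
triangle zero    = 0
triangle (suc j) = j + triangle j

double-triangle : ∀ j → 2 * triangle (suc j) ≡ j * suc j
double-triangle zero    = refl
double-triangle (suc j) = trans (*-distribˡ-+ 2 (suc j) (triangle (suc j)))
  (trans (cong (2 * suc j +_) (double-triangle j)) (identity j))
  where
  identity : ∀ j → 2 * suc j + j * suc j ≡ suc j * suc (suc j)
  identity = solve-∀

module Peeling {V : Set} (_≟_ : DecidableEquality V) (N : V → V → Set) (N? : ∀ u → Decidable (N u)) where

  record Core (U W : List V) : Set where
    field
      U′ W′    : List V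
      U′⊆U     : ∀ {u} → u ∈ U′ → u ∈ U
      W′⊆W     : ∀ {w} → w ∈ W′ → w ∈ W
      unique-W : Unique W′
      nonempty : 0 < length W′
      closed   : ∀ {u w} → w ∈ W′ → N u w → u ∈ U′
      rich     : ∀ {u} → u ∈ U′ → length U′ ≤ length (filter (N? u) W′)

  -- A vertex of U with fewer than |U| neighbours in W is deleted together with them. This
  -- costs at most (j - 1) + ... + 1 + 0 vertices of W in total.
  core : ∀ j U W → length U ≤ j → Unique W → triangle j < length W →
         (∀ {u w} → w ∈ W → N u w → u ∈ U) → Core U W
  core j U W U≤j uW large closed with some? (λ u → length (filter (N? u) W) <? length U) U
  ... | inj₂ none = record
        { U′ = U ; W′ = W ; U′⊆U = id ; W′⊆W = id ; unique-W = uW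
        ; nonempty = ≤-<-trans z≤n large ; closed = closed ; rich = ≮⇒≥ ∘ none }
  core zero    [] W U≤j uW large closed | inj₁ (u , () , _)
  core (suc j) U W U≤j uW large closed | inj₁ (u , u∈ , poor) = record
    { U′ = U′ ; W′ = W′ ; U′⊆U = proj₁ ∘ ∈-filter⁻ other? ∘ U′⊆U
    ; W′⊆W = proj₁ ∘ ∈-filter⁻ far? ∘ W′⊆W ; unique-W = unique-W
    ; nonempty = nonempty ; closed = closed′ ; rich = rich }
    where
    other? : Decidable (_≢ u)
    other? v = ¬? (v ≟ u)

    far? : Decidable (λ w → ¬ N u w)
    far? w = ¬? (N? u w)

    large′ : triangle j < length (filter far? W)
    -- The vertex `u` has fewer than `length U` neighbours in `W`, and `length U` is at most
    -- `suc j`; so at most `j` vertices go, which is the drop of the triangle number.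
    large′ = +-cancelˡ-< j _ _ (<-≤-trans large (subst (_≤ j + length (filter far? W))
      (length-filter-split (N? u) W) (+-monoˡ-≤ _ (s≤s⁻¹ (≤-trans poor U≤j)))))

    rest : Core (filter other? U) (filter far? W)
    rest = core j (filter other? U) (filter far? W)
      (s≤s⁻¹ (≤-trans (length-filter-delete other? u∈ λ u≢u → u≢u refl) U≤j))
      (Uniqueₚ.filter⁺ far? uW) large′
      λ w∈ n → let w∈W , far = ∈-filter⁻ far? w∈
               in ∈-filter⁺ other? (closed w∈W n) λ { refl → far n }

    open Core rest renaming (closed to closed′)

-- Edges, degrees and colourings of subgraphs.

countTrue-filter : {A : Set} (f : A → Bool) (xs : List A) → countTrue (map f xs) ≡ length (filter (T? ∘ f) xs)
countTrue-filter f [] = refl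
countTrue-filter f (x ∷ xs) with f x
... | true  = cong suc (countTrue-filter f xs)
... | false = countTrue-filter f xs

module Edges (G : Graph) where

  _≟ⱽ_ : DecidableEquality (Vertex G)
  _≟ⱽ_ = Finₚ._≟_

  e₁ e₂ : Edge G → Vertex G
  e₁ = end₁ {G}
  e₂ = end₂ {G}

  edge-≡ : {e f : Edge G} → e₁ e ≡ e₁ f → e₂ e ≡ e₂ f → e ≡ f
  edge-≡ {u , v , p , a} {.u , .v , q , b} refl refl =
    cong₂ (λ p a → u , v , p , a) (<-irrelevant p q) (Boolₚ.T-irrelevant a b)

  _≟ᴱ_ : DecidableEquality (Edge G)
  e ≟ᴱ f = map′ (λ (p , q) → edge-≡ p q) (λ { refl → refl , refl }) ((e₁ e ≟ⱽ e₁ f) ×-dec (e₂ e ≟ⱽ e₂ f))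

  Joins : Edge G → Vertex G → Vertex G → Set
  Joins e u v = (e₁ e ≡ u × e₂ e ≡ v) ⊎ (e₁ e ≡ v × e₂ e ≡ u)

  joins-swap : ∀ e {u v} → Joins e u v → Joins e v u
  joins-swap _ = [ inj₂ , inj₁ ]′

  ends-≢ : ∀ e → e₁ e ≢ e₂ e
  ends-≢ (_ , _ , u<v , _) refl = <-irrefl refl u<v

  joins-adj : ∀ e {u v} → Joins e u v → Adj G u v
  joins-adj (_ , _ , _ , a) (inj₁ (refl , refl)) = a
  joins-adj (u , v , _ , a) (inj₂ (refl , refl)) = subst T (Graph.sym G u v) a

  joins-injective : ∀ {e f u v} → Joins e u v → Joins f u v → e ≡ f
  joins-injective (inj₁ (refl , refl)) (inj₁ (p , q)) = edge-≡ (≡-sym p) (≡-sym q)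
  joins-injective (inj₂ (refl , refl)) (inj₂ (p , q)) = edge-≡ (≡-sym p) (≡-sym q)
  joins-injective {_ , _ , u<v , _} {_ , _ , v<u , _} (inj₁ (refl , refl)) (inj₂ (refl , refl)) =
    contradiction u<v (<-asym v<u)
  joins-injective {_ , _ , u<v , _} {_ , _ , v<u , _} (inj₂ (refl , refl)) (inj₁ (refl , refl)) =
    contradiction u<v (<-asym v<u)

  adj⇒joins : ∀ {u v} → Adj G u v → ∃[ e ] Joins e u v
  adj⇒joins {u} {v} a with <-cmp (Fin.toℕ u) (Fin.toℕ v)
  ... | tri< lt _ _ = (u , v , lt , a) , inj₁ (refl , refl)
  ... | tri> _ _ gt = (v , u , gt , subst T (Graph.sym G u v) a) , inj₂ (refl , refl)
  ... | tri≈ _ eq _ with Finₚ.toℕ-injective eq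
  ...   | refl = ⊥-elim (subst T (Graph.irrefl G u) a)

  Incident : Vertex G → Edge G → Set
  Incident z e = e₁ e ≡ z ⊎ e₂ e ≡ z

  incident? : ∀ z → Decidable (Incident z)
  incident? z e = (e₁ e ≟ⱽ z) ⊎-dec (e₂ e ≟ⱽ z)

  joins⇒incident : ∀ e {u v} → Joins e u v → Incident u e
  joins⇒incident _ = [ inj₁ ∘ proj₁ , inj₂ ∘ proj₂ ]′

  -- Meaningful only if `z` is an end of `e`; otherwise the value is a default.
  other : Vertex G → Edge G → Vertex G
  other z e with e₁ e ≟ⱽ z
  ... | yes _ = e₂ e
  ... | no _  = e₁ e

  incident⇒joins : ∀ {z e} → Incident z e → Joins e z (other z e)
  incident⇒joins {z} {e} inc with e₁ e ≟ⱽ z | inc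
  ... | yes p | _      = inj₁ (p , refl)
  ... | no ¬p | inj₁ p = contradiction p ¬p
  ... | no _  | inj₂ p = inj₂ (refl , p)

  joins-unique : ∀ {e z v w} → Joins e z v → Joins e z w → v ≡ w
  joins-unique {e} (inj₁ (p , q)) (inj₁ (_ , r)) = trans (≡-sym q) r
  joins-unique {e} (inj₂ (q , p)) (inj₂ (r , _)) = trans (≡-sym q) r
  joins-unique {e} (inj₁ (p , q)) (inj₂ (_ , r)) = contradiction (trans p (≡-sym r)) (ends-≢ e)
  joins-unique {e} (inj₂ (q , p)) (inj₁ (r , _)) = contradiction (trans r (≡-sym p)) (ends-≢ e)

  joins-other : ∀ e {z v} → Joins e z v → other z e ≡ v
  joins-other e j = joins-unique {e} (incident⇒joins (joins⇒incident e j)) j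

  edges-between : ∀ u v → List (Edge G)
  edges-between u v with Fin.toℕ u <? Fin.toℕ v | T? (adj G u v)
  ... | yes lt | yes a = (u , v , lt , a) ∷ []
  ... | _      | _     = []

  -- With deduplication, uniqueness is immediate and the enumeration only has to be complete.
  allEdges : List (Edge G)
  allEdges = deduplicate _≟ᴱ_ (concatMap (λ u → concatMap (edges-between u) (allFin (n G))) (allFin (n G)))

  nbrs : List (Edge G) → Vertex G → List (Vertex G)
  nbrs A v = map (other v) (filter (incident? v) A)

  deg : List (Edge G) → Vertex G → ℕ
  deg A v = length (filter (incident? v) A)

  -- Subgraphs are edge lists over the fixed vertex set; this is adjacency in the subgraph `A`.
  Joined : List (Edge G) → Vertex G → Vertex G → Set
  Joined A u v = ∃[ e ] (e ∈ A × Joins e u v)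

  joined? : ∀ A u → Decidable (Joined A u)
  joined? A u v = map′ find (λ (_ , e∈ , j) → lose e∈ j) (any? joins? A)
    where
    joins? : Decidable (λ e → Joins e u v)
    joins? e = ((e₁ e ≟ⱽ u) ×-dec (e₂ e ≟ⱽ v)) ⊎-dec ((e₁ e ≟ⱽ v) ×-dec (e₂ e ≟ⱽ u))

  joined-swap : ∀ {A u v} → Joined A u v → Joined A v u
  joined-swap (e , e∈ , j) = e , e∈ , joins-swap e j

  nbrs⁺ : ∀ {A v w} → Joined A v w → w ∈ nbrs A v
  nbrs⁺ {A} {v} (e , e∈ , j) =
    subst (_∈ nbrs A v) (joins-other e j)
      (∈-map⁺ (other v) (∈-filter⁺ (incident? v) {xs = A} e∈ (joins⇒incident e j)))

  nbrs⁻ : ∀ {A v w} → w ∈ nbrs A v → Joined A v w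
  nbrs⁻ {A} {v} w∈ with ∈-map⁻ (other v) w∈
  ... | e , e∈ , refl with ∈-filter⁻ (incident? v) {xs = A} e∈
  ...   | e∈A , inc = e , e∈A , incident⇒joins inc

  length-nbrs : ∀ A v → length (nbrs A v) ≡ deg A v
  length-nbrs A v = length-map (other v) (filter (incident? v) A)

  unique-nbrs : ∀ {A} → Unique A → ∀ v → Unique (nbrs A v)
  unique-nbrs {A} uA v = unique-map (other v) (Uniqueₚ.filter⁺ (incident? v) uA) λ {e} {f} e∈ f∈ eq →
    joins-injective (incident⇒joins (proj₂ (∈-filter⁻ (incident? v) {xs = A} e∈)))
      (subst (Joins f v) (≡-sym eq) (incident⇒joins (proj₂ (∈-filter⁻ (incident? v) {xs = A} f∈))))

  unique-allEdges : Unique allEdges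
  unique-allEdges = deduplicate-! _≟ᴱ_ _

  ∈-allEdges : ∀ e → e ∈ allEdges
  ∈-allEdges e@(u , v , lt , a) = ∈-deduplicate⁺ _≟ᴱ_
    (∈-concatMap⁺ _ (lose (∈-allFin u) (∈-concatMap⁺ _ (lose (∈-allFin v) between))))
    where
    between : e ∈ edges-between u v
    between with Fin.toℕ u <? Fin.toℕ v | T? (adj G u v)
    ... | yes _  | yes _ = here (edge-≡ refl refl)
    ... | no ¬lt | _     = contradiction lt ¬lt
    ... | yes _  | no ¬a = contradiction a ¬a

  deg≤degree : ∀ {A} → Unique A → ∀ v → deg A v ≤ degree G v
  deg≤degree {A} uA v = subst₂ _≤_ (length-nbrs A v) (≡-sym (countTrue-filter (adj G v) (allFin (n G))))
    (length-mono (unique-nbrs uA v) λ w∈ →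
      let e , _ , j = nbrs⁻ {A} w∈ in ∈-filter⁺ (T? ∘ adj G v) (∈-allFin _) (joins-adj e j))

  degree≤deg : ∀ v → degree G v ≤ deg allEdges v
  degree≤deg v = subst₂ _≤_ (≡-sym (countTrue-filter (adj G v) (allFin (n G)))) (length-nbrs allEdges v)
    (length-mono (Uniqueₚ.filter⁺ (T? ∘ adj G v) (Uniqueₚ.allFin⁺ (n G))) λ w∈ →
      let e , j = adj⇒joins (proj₂ (∈-filter⁻ (T? ∘ adj G v) {xs = allFin (n G)} w∈))
      in nbrs⁺ {allEdges} (e , ∈-allEdges e , j))

  ProperOn : List (Edge G) → (Edge G → ℕ) → Set
  ProperOn A γ = ∀ {e f z} → e ∈ A → f ∈ A → e ≢ f → Incident z e → Incident z f → γ e ≢ γ f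

  ListColouring : List (Edge G) → (Edge G → List ℕ) → Set
  ListColouring A L = Σ[ γ ∈ (Edge G → ℕ) ] ((∀ {e} → e ∈ A → γ e ∈ L e) × ProperOn A γ)

  Touches : Edge G → Edge G → Set
  Touches e f = Incident (e₁ e) f ⊎ Incident (e₂ e) f

  touches? : ∀ e → Decidable (Touches e)
  touches? e f = incident? (e₁ e) f ⊎-dec incident? (e₂ e) f

  common-end⇒touches : ∀ e f {z} → Incident z e → Incident z f → Touches e f
  common-end⇒touches _ _ (inj₁ refl) i = inj₁ i
  common-end⇒touches _ _ (inj₂ refl) i = inj₂ i

  module _ {P : Edge G → Set} (P? : Decidable P) (A : List (Edge G)) where

    inside outside : List (Edge G)
    inside  = filter P? A
    outside = filter (¬? ∘ P?) A

    -- With the outer edges coloured, an inner edge strikes from its list the colours of the outer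
    -- edges touching it, at most one for each. The remaining length is bounded through a sum, which
    -- avoids truncated subtraction.
    extend-colouring : (L : Edge G → List ℕ) → (∀ e → Unique (L e)) → ListColouring outside L →
      (∀ L′ → (∀ {e} → e ∈ inside → Unique (L′ e) ×
                  length (L e) ≤ length (filter (touches? e) outside) + length (L′ e)) →
              ListColouring inside L′) →
      ListColouring A L
    extend-colouring L uL (γ , γ∈ , γ-proper) finish =
      combine (finish L′ λ {e} _ → Uniqueₚ.filter⁺ (free? e) (uL e) , enough e)
      where
      used : Edge G → List ℕ
      used e = map γ (filter (touches? e) outside)

      used? : ∀ e → Decidable (_∈ used e)
      used? e a = any? (a ℕₚ.≟_) (used e)

      free? : ∀ e → Decidable (_∉ used e)
      free? e = ¬? ∘ used? e

      L′ : Edge G → List ℕ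
      L′ e = filter (free? e) (L e)

      enough : ∀ e → length (L e) ≤ length (filter (touches? e) outside) + length (L′ e)
      enough e = subst (_≤ length (filter (touches? e) outside) + length (L′ e))
        (length-filter-split (used? e) (L e)) (+-monoˡ-≤ (length (L′ e))
        (subst (length (filter (used? e) (L e)) ≤_) (length-map γ (filter (touches? e) outside))
          (length-mono (Uniqueₚ.filter⁺ (used? e) (uL e)) λ a∈ → proj₂ (∈-filter⁻ (used? e) {xs = L e} a∈))))

      combine : ListColouring inside L′ → ListColouring A L
      combine (δ , δ∈ , δ-proper) = γ⁺ , γ⁺∈ , γ⁺-proper
        where
        γ⁺ : Edge G → ℕ
        γ⁺ e with P? e
        ... | yes _ = δ e
        ... | no _  = γ e

        δ-free : ∀ {e} → e ∈ A → P e → δ e ∈ L e × δ e ∉ used e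
        δ-free {e} e∈ p = ∈-filter⁻ (free? e) (δ∈ (∈-filter⁺ P? e∈ p))

        γ⁺∈ : ∀ {e} → e ∈ A → γ⁺ e ∈ L e
        γ⁺∈ {e} e∈ with P? e
        ... | yes p = proj₁ (δ-free e∈ p)
        ... | no ¬p = γ∈ (∈-filter⁺ (¬? ∘ P?) e∈ ¬p)

        mixed : ∀ {e f z} → e ∈ A → f ∈ A → P e → ¬ P f → Incident z e → Incident z f → δ e ≢ γ f
        mixed {e} {f} e∈ f∈ pe ¬pf ie jf eq = proj₂ (δ-free e∈ pe) (subst (_∈ used e) (≡-sym eq)
          (∈-map⁺ γ (∈-filter⁺ (touches? e) (∈-filter⁺ (¬? ∘ P?) f∈ ¬pf) (common-end⇒touches e f ie jf))))

        γ⁺-proper : ProperOn A γ⁺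
        γ⁺-proper {e} {f} e∈ f∈ e≢f ie jf with P? e | P? f
        ... | yes pe | yes pf = δ-proper (∈-filter⁺ P? e∈ pe) (∈-filter⁺ P? f∈ pf) e≢f ie jf
        ... | yes pe | no ¬pf = mixed e∈ f∈ pe ¬pf ie jf
        ... | no ¬pe | yes pf = mixed f∈ e∈ pf ¬pe jf ie ∘ ≡-sym
        ... | no ¬pe | no ¬pf = γ-proper (∈-filter⁺ (¬? ∘ P?) e∈ ¬pe) (∈-filter⁺ (¬? ∘ P?) f∈ ¬pf) e≢f ie jf

-- Walks, paths and rooted trees.

module Walks (G : Graph) where

  adj-sym : ∀ {u v} → Adj G u v → Adj G v u
  adj-sym {u} {v} = subst T (Graph.sym G u v)

  module _ {P : Vertex G → Set} where

    walk-start : ∀ {u v} → WalkIn G P u v → P u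
    walk-start (here p)     = p
    walk-start (step p _ _) = p

    walk-end : ∀ {u v} → WalkIn G P u v → P v
    walk-end (here p)     = p
    walk-end (step _ _ w) = walk-end w

    walk-++ : ∀ {u v w} → WalkIn G P u v → WalkIn G P v w → WalkIn G P u w
    walk-++ (here _)     w = w
    walk-++ (step p a v) w = step p a (walk-++ v w)

    walk-reverse : ∀ {u v} → WalkIn G P u v → WalkIn G P v u
    walk-reverse (here p)     = here p
    walk-reverse (step p a w) = walk-++ (walk-reverse w) (step (walk-start w) (adj-sym a) (here p))

    data Path : Vertex G → Vertex G → List (Vertex G) → Set where
      single : ∀ {v} → P v → Path v v (v ∷ [])
      cons   : ∀ {u w v xs} → P u → Adj G u w → u ∉ xs → Path w v xs → Path u v (u ∷ xs)

    path-from : ∀ {u v w xs} → Path w v xs → u ∈ xs → ∃[ ys ] Path u v ys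
    path-from p@(single _)     (here refl) = _ , p
    path-from p@(cons _ _ _ _) (here refl) = _ , p
    path-from (cons _ _ _ p)   (there u∈)  = path-from p u∈

    walk⇒path : ∀ {u v} → WalkIn G P u v → ∃[ xs ] Path u v xs
    walk⇒path (here p) = _ , single p
    walk⇒path {u} (step p a w) with walk⇒path w
    ... | xs , path with any? (u Finₚ.≟_) xs
    ...   | yes u∈ = path-from path u∈
    ...   | no u∉  = _ , cons p a u∉ path

    path-unique : ∀ {u v xs} → Path u v xs → Unique xs
    path-unique (single _)        = [] ∷ []
    path-unique (cons _ _ u∉ p)   = All.tabulate (λ { z∈ refl → u∉ z∈ }) ∷ path-unique p

    path-all : ∀ {u v xs} → Path u v xs → All P xs
    path-all (single p)      = p ∷ []
    path-all (cons p _ _ ps) = p ∷ path-all ps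

    path-length : ∀ {u v xs} → u ≢ v → Path u v xs → 2 ≤ length xs
    path-length u≢u (single _)                 = contradiction refl u≢u
    path-length _   (cons _ _ _ (single _))     = s≤s (s≤s z≤n)
    path-length _   (cons _ _ _ (cons _ _ _ _)) = s≤s (s≤s z≤n)

    path-linked : ∀ {s u v t xs} → Adj G s u → Path u v xs → Adj G v t → Linked (Adj G) (s ∷ xs ++ t ∷ [])
    path-linked a (single _)      b = a ∷ b ∷ [-]
    path-linked a (cons _ a′ _ p) b = a ∷ path-linked a′ p b

  -- Otherwise the walk, shortened to a path and closed up through `t`, would be a cycle; it has at
  -- least three vertices because `p` and `q` differ.
  no-detour : Acyclic G → ∀ {t p q} → Adj G t p → Adj G t q → WalkIn G (_≢ t) p q → p ≡ q
  no-detour acyclic {t} {p} {q} tp tq walk with p Finₚ.≟ q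
  ... | yes p≡q = p≡q
  ... | no p≢q with walk⇒path walk
  ...   | xs , path = ⊥-elim (acyclic (t ∷ xs)
          ( s≤s (path-length p≢q path)
          , All.map (λ z≢t t≡z → z≢t (≡-sym t≡z)) (path-all path) ∷ path-unique path
          , path-linked tp path (adj-sym tq) ))

least : {P : ℕ → Set} → Decidable P → ∀ {ℓ} → P ℓ → ∃[ m ] (P m × (∀ {j} → P j → m ≤ j))
least {P} P? {ℓ} pℓ with min-by id (∈-filter⁺ P? (∈-upTo⁺ (n<1+n ℓ)) pℓ)
... | m , m∈ , best = m , proj₂ (∈-filter⁻ P? {xs = upTo (suc ℓ)} m∈) , minimal
  where
  minimal : ∀ {j} → P j → m ≤ j
  minimal {j} pj with j ≤? ℓ
  ... | yes j≤ℓ = best (∈-filter⁺ P? (∈-upTo⁺ (s≤s j≤ℓ)) pj)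
  ... | no j≰ℓ  = ≤-trans (best (∈-filter⁺ P? (∈-upTo⁺ (n<1+n ℓ)) pℓ)) (<⇒≤ (≰⇒> j≰ℓ))

module RootedTree (G : Graph) (connected : Connected G) (acyclic : Acyclic G) (root : Vertex G) where

  open Walks G

  -- Walks graded by length, decidable by a search for the next vertex; the least possible length
  -- serves as the depth.
  RootWalk : ℕ → Vertex G → Set
  RootWalk zero    s = s ≡ root
  RootWalk (suc ℓ) s = ∃[ w ] (Adj G s w × RootWalk ℓ w)

  rootWalk? : ∀ ℓ → Decidable (RootWalk ℓ)
  rootWalk? zero    s = s Finₚ.≟ root
  rootWalk? (suc ℓ) s = Finₚ.any? λ w → T? (adj G s w) ×-dec rootWalk? ℓ w

  walk⇒rootWalk : ∀ {P s} → WalkIn G P s root → ∃[ ℓ ] RootWalk ℓ s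
  walk⇒rootWalk (here _)     = 0 , refl
  walk⇒rootWalk (step _ a w) = let ℓ , rw = walk⇒rootWalk w in suc ℓ , _ , a , rw

  opaque
    shortest : ∀ s → ∃[ m ] (RootWalk m s × (∀ {j} → RootWalk j s → m ≤ j))
    shortest s = least (λ ℓ → rootWalk? ℓ s) (proj₂ (walk⇒rootWalk (connected s root)))

  depth : Vertex G → ℕ
  depth s = proj₁ (shortest s)

  depth-zero : ∀ s → depth s ≡ 0 → s ≡ root
  depth-zero s eq = subst (λ m → RootWalk m s) eq (proj₁ (proj₂ (shortest s)))

  parent : ∀ s {d} → depth s ≡ suc d → ∃[ w ] (Adj G s w × depth w ≤ d)
  parent s eq =
    let w , a , rw = subst (λ m → RootWalk m s) eq (proj₁ (proj₂ (shortest s)))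
    in w , a , proj₂ (proj₂ (shortest w)) rw

  -- The negation plays the role of the descendant relation: `s` lies in the subtree hanging at `t`,
  -- where `t` itself is included.
  Avoids : Vertex G → Vertex G → Set
  Avoids t s = WalkIn G (_≢ t) s root

  -- The climb from `s` along parents meets only depths smaller than that of `s`, hence never `t`.
  shallow-avoids : ∀ {t} d {s} → depth s ≤ d → s ≢ t → depth s ≤ depth t → Avoids t s
  shallow-avoids d {s} _ s≢t s≤t with depth s in eq
  shallow-avoids d {s} _ s≢t s≤t | zero with depth-zero s eq
  ... | refl = here s≢t
  shallow-avoids (suc d) {s} (s≤s k≤d) s≢t s≤t | suc k with parent s eq
  ... | w , a , w≤k = step s≢t a (shallow-avoids d (≤-trans w≤k k≤d)
          (λ { refl → <-irrefl refl (<-≤-trans s≤t w≤k) }) (≤-trans w≤k (<⇒≤ s≤t)))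

  -- A walk inside P that enters t from s, followed from s to the root off t, would close a
  -- cycle unless s is the parent of t.
  top-separates : ∀ {P t s} → (∀ {u} → P u → depth t ≤ depth u) → WalkIn G P s t → ¬ Avoids t s
  top-separates min (here _) av = walk-start av refl
  top-separates {t = t} min (step {u} {w} pu a rest) av with w Finₚ.≟ t
  -- Until the walk enters `t`, its current vertex reaches the root off `t` by retracing one step.
  ... | no w≢t = top-separates min rest (step w≢t (adj-sym a) av)
  ... | yes refl with depth t in eq
  ...   | zero with depth-zero t eq
  ...     | refl = walk-end av refl
  top-separates {t = t} min (step {u} {w} pu a rest) av | yes refl | suc d with parent t eq
  -- Here `t` was entered from its parent, which is shallower than `t`, although `P` holds only at
  -- vertices at least as deep.
  ... | p , tp , p≤d = <-irrefl refl (<-≤-trans (s≤s p≤d) (subst (suc d ≤_) (cong depth u≡p) (min pu)))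
    where
    p≢t : p ≢ t
    p≢t refl = <-irrefl refl (subst (_≤ d) eq p≤d)

    u≡p : u ≡ p
    u≡p = no-detour acyclic (adj-sym a) tp (walk-++ av
      (walk-reverse (shallow-avoids (depth p) ≤-refl p≢t (≤-trans p≤d (≤-trans (n≤1+n d) (≤-reflexive (≡-sym eq)))))))

-- Topmost bags in a rooted tree decomposition.

module Decomposed (G : Graph) (D : TreeDecomposition G) (root : Vertex (tree D)) where

  open RootedTree (tree D) (proj₁ (proj₂ (isTree D))) (proj₂ (proj₂ (isTree D))) root
  open Walks (tree D)

  In : Vertex G → Vertex (tree D) → Set
  In v t = T (bag D t v)

  in? : ∀ v → Decidable (In v)
  in? v t = T? (bag D t v)

  opaque
    top : ∀ v → ∃[ t ] (In v t × (∀ {s} → In v s → depth t ≤ depth s))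
    top v with min-by depth (∈-filter⁺ (in? v) (∈-allFin (proj₁ (covers D v))) (proj₂ (covers D v)))
    ... | t , t∈ , best = t , proj₂ (∈-filter⁻ (in? v) {xs = allFin (n (tree D))} t∈) ,
                          λ s∈ → best (∈-filter⁺ (in? v) (∈-allFin _) s∈)

  level : Vertex G → ℕ
  level v = depth (proj₁ (top v))

  -- The nodes whose bags contain `x` are connected and miss `t`, so they all lie on one side of
  -- `t`.
  off : ∀ {x t s s′} → ¬ In x t → In x s → In x s′ → Avoids t s′ → Avoids t s
  off {x} {t} {s} {s′} x∉ s∈ s′∈ av = walk-++ (weaken (subtree D x s s′ s∈ s′∈)) av
    where
    weaken : ∀ {a b} → WalkIn (tree D) (In x) a b → WalkIn (tree D) (_≢ t) a b
    weaken (here p)     = here λ { refl → x∉ p }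
    weaken (step p a w) = step (λ { refl → x∉ p }) a (weaken w)

  -- If the bag of `t` missed `x`, the whole subtree of `x` would hang below `t` along with `s`; but
  -- its top is no deeper than `t`.
  spans : ∀ {x t s} → In x s → ¬ Avoids t s → level x ≤ depth t → In x t
  spans {x} {t} {s} s∈ below shallow = decidable-stable (in? x t) λ x∉ →
    let tx , tx∈ , _ = top x
    in below (off x∉ s∈ tx∈ (shallow-avoids (depth tx) ≤-refl (λ { refl → x∉ tx∈ }) shallow))

  opaque
    -- Take v with the deepest top bag t among all big vertices.
    isolate : {Big : Vertex G → Set} → Decidable Big → ∀ {v₀} → Big v₀ →
      ∃[ v ] ∃[ t ] (Big v × In v t ×
        (∀ {w} → Adj G v w → ¬ In w t → ¬ Big w × (∀ {x} → Adj G w x → Big x → In x t)))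
    isolate {Big} Big? big₀ with max-by level (∈-filter⁺ Big? (∈-allFin _) big₀)
    ... | v , v∈ , best with top v
    ...   | t , t∈ , min = v , t , proj₂ (∈-filter⁻ Big? {xs = allFin (n G)} v∈) , t∈ ,
                                λ a w∉ → small a w∉ , near a w∉
      where
      big-shallow : ∀ {x} → Big x → level x ≤ depth t
      big-shallow bx = best (∈-filter⁺ Big? (∈-allFin _) bx)

      -- The bag containing the edge belongs to the subtree of `v`, whose topmost node is `t`, so
      -- its node lies below `t`.
      shared : ∀ {w} → Adj G v w → ∃[ s ] (In w s × ¬ Avoids t s)
      shared a with edgeIn D _ _ a
      ... | s , v∈s , w∈s = s , w∈s , top-separates min (subtree D v s t v∈s t∈)

      small : ∀ {w} → Adj G v w → ¬ In w t → ¬ Big w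
      small a w∉ bw = let s , w∈s , below = shared a in w∉ (spans w∈s below (big-shallow bw))

      -- Since `w` is not in the bag of `t`, all bags of `w` lie below `t`, among them the one
      -- shared with `x`; the top of the big vertex `x` is no deeper than `t`.
      near : ∀ {w} → Adj G v w → ¬ In w t → ∀ {x} → Adj G w x → Big x → In x t
      near a w∉ wx bx with edgeIn D _ _ wx | shared a
      ... | s′ , w∈s′ , x∈s′ | s , w∈s , below =
            spans x∈s′ (λ av → below (off w∉ w∈s w∈s′ av)) (big-shallow bx)

-- The two reductions: a light edge and a rich bipartite piece.

module Reduction (G : Graph) where

  open Edges G

  module _ (A : List (Edge G)) (uA : Unique A) (m : ℕ) (L : Edge G → List ℕ)
    (uL : ∀ e → Unique (L e)) (length-L : ∀ e → length (L e) ≡ m) where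

    -- The edge `e` counts once at either end, so at most `m - 1` other edges touch it and its list
    -- retains a colour.
    colour-light : ∀ {e} → e ∈ A → deg A (e₁ e) + deg A (e₂ e) ≤ suc m →
                   ListColouring (filter (¬? ∘ (_≟ᴱ e)) A) L → ListColouring A L
    colour-light {e} e∈ light γ = extend-colouring only? A L uL γ single
      where
      only? : Decidable (_≡ e)
      only? = _≟ᴱ e

      rest = outside only? A

      fewer : ∀ {z} → Incident z e → deg rest z < deg A z
      fewer {z} inc = filter-mono-< (incident? z) (incident? z) (Uniqueₚ.filter⁺ (¬? ∘ only?) uA)
        (λ f∈ i → proj₁ (∈-filter⁻ (¬? ∘ only?) f∈) , i) e∈ inc
        λ e∈′ _ → proj₂ (∈-filter⁻ (¬? ∘ only?) {xs = A} e∈′) refl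

      touching : length (filter (touches? e) rest) < m
      touching = s≤s⁻¹ (begin
        suc (suc (length (filter (touches? e) rest)))
          ≤⟨ s≤s (s≤s (length-filter-⊎ (incident? (e₁ e)) (incident? (e₂ e)) rest)) ⟩
        suc (suc (deg rest (e₁ e) + deg rest (e₂ e)))  ≡⟨ cong suc (≡-sym (+-suc _ _)) ⟩
        suc (deg rest (e₁ e)) + suc (deg rest (e₂ e))  ≤⟨ +-mono-≤ (fewer (inj₁ refl)) (fewer (inj₂ refl)) ⟩
        deg A (e₁ e) + deg A (e₂ e)                    ≤⟨ light ⟩
        suc m                                          ∎)
        where open ≤-Reasoning

      single : ∀ L′ → (∀ {f} → f ∈ inside only? A → Unique (L′ f) ×
                 length (L f) ≤ length (filter (touches? f) rest) + length (L′ f)) →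
               ListColouring (inside only? A) L′
      single L′ long with L′ e in eq | proj₂ (long (∈-filter⁺ only? e∈ refl))
      ... | []    | short = contradiction (subst₂ _≤_ (length-L e) (+-identityʳ _) short) (<⇒≱ touching)
      ... | a ∷ _ | _     = (λ _ → a) , member , λ f∈ g∈ f≢g →
            contradiction (trans (is-e f∈) (≡-sym (is-e g∈))) f≢g
        where
        is-e : ∀ {f} → f ∈ inside only? A → f ≡ e
        is-e f∈ = proj₂ (∈-filter⁻ only? {xs = A} f∈)

        member : ∀ {f} → f ∈ inside only? A → a ∈ L′ f
        member f∈ with is-e f∈
        ... | refl = subst (a ∈_) (≡-sym eq) (here refl)

    module _ (deg≤m : ∀ v → deg A v ≤ m) (U W : List (Vertex G)) (disjoint : ∀ {z} → z ∈ U → z ∉ W)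
      (closed : ∀ {u w} → w ∈ W → Joined A u w → u ∈ U)
      (uW : Unique W) (rich : ∀ {u} → u ∈ U → length U ≤ length (filter (joined? A u) W)) where

      in-W? : Decidable (_∈ W)
      in-W? v = any? (v ≟ⱽ_) W

      hits? : Decidable (λ e → e₁ e ∈ W ⊎ e₂ e ∈ W)
      hits? e = in-W? (e₁ e) ⊎-dec in-W? (e₂ e)

      H = inside hits? A
      R = outside hits? A

      uH : Unique H
      uH = Uniqueₚ.filter⁺ hits? uA

      uR : Unique R
      uR = Uniqueₚ.filter⁺ (¬? ∘ hits?) uA

      -- On `H`, `y` is the end in `W` and `x` the end in `U`: `closed` and `disjoint` leave each
      -- edge of `H` exactly one end in `W`.
      x y : Edge G → Vertex G
      x e with in-W? (e₁ e)
      ... | yes _ = e₂ e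
      ... | no _  = e₁ e
      y e with in-W? (e₁ e)
      ... | yes _ = e₁ e
      ... | no _  = e₂ e

      joins-xy : ∀ e → Joins e (x e) (y e)
      joins-xy e with in-W? (e₁ e)
      ... | yes _ = inj₂ (refl , refl)
      ... | no _  = inj₁ (refl , refl)

      H⊆A : ∀ {e} → e ∈ H → e ∈ A
      H⊆A e∈ = proj₁ (∈-filter⁻ hits? e∈)

      y∈W : ∀ {e} → e ∈ H → y e ∈ W
      y∈W {e} e∈ with in-W? (e₁ e) | proj₂ (∈-filter⁻ hits? {xs = A} e∈)
      ... | yes p | _      = p
      ... | no ¬p | inj₁ p = contradiction p ¬p
      ... | no _  | inj₂ p = p

      x∈U : ∀ {e} → e ∈ H → x e ∈ U
      x∈U {e} e∈ = closed (y∈W e∈) (e , H⊆A e∈ , joins-xy e)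

      incident-xy : ∀ {z e} → Incident z e → x e ≡ z ⊎ y e ≡ z
      incident-xy {z} {e} i with in-W? (e₁ e) | i
      ... | yes _ | inj₁ p = inj₂ p
      ... | yes _ | inj₂ p = inj₁ p
      ... | no _  | inj₁ p = inj₁ p
      ... | no _  | inj₂ p = inj₂ p

      incident-x : ∀ e → Incident (x e) e
      incident-x e = joins⇒incident e (joins-xy e)

      incident-W : ∀ {z} e → z ∈ W → Incident z e → e₁ e ∈ W ⊎ e₂ e ∈ W
      incident-W _ z∈ (inj₁ refl) = inj₁ z∈
      incident-W _ z∈ (inj₂ refl) = inj₂ z∈

      open Bipartite _≟ᴱ_ _≟ⱽ_ x y using (Adjacent; Proper)
      open König _≟ᴱ_ _≟ⱽ_ x y using (degree-at)
      open BipartiteListColouring _≟ᴱ_ _≟ⱽ_ x y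

      adjacent : ∀ {e f z} → e ∈ H → f ∈ H → Incident z e → Incident z f → Adjacent e f
      adjacent e∈ f∈ ie jf with incident-xy ie | incident-xy jf
      ... | inj₁ p | inj₁ q = inj₁ (trans p (≡-sym q))
      ... | inj₂ p | inj₂ q = inj₂ (trans p (≡-sym q))
      ... | inj₁ p | inj₂ q = contradiction (subst (_∈ W) (trans q (≡-sym p)) (y∈W f∈)) (disjoint (x∈U e∈))
      ... | inj₂ p | inj₁ q = contradiction (subst (_∈ W) (trans p (≡-sym q)) (y∈W e∈)) (disjoint (x∈U f∈))

      degree-x : ∀ u → degree-at x u H ≤ deg H u
      degree-x u = filter-mono (λ f → x f ≟ⱽ u) (incident? u) uH λ {f} f∈ xf →
        f∈ , subst (λ z → Incident z f) xf (incident-x f)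

      degree-y : ∀ w → degree-at y w H ≤ length U
      degree-y w = subst (_≤ length U) (length-map x at-w)
        (length-mono (unique-map x (Uniqueₚ.filter⁺ (λ f → y f ≟ⱽ w) uH) injective) into-U)
        where
        at-w = filter (λ f → y f ≟ⱽ w) H

        injective : ∀ {f g} → f ∈ at-w → g ∈ at-w → x f ≡ x g → f ≡ g
        injective {f} {g} f∈ g∈ eq = joins-injective (joins-xy f)
          (subst₂ (Joins g) (≡-sym eq) (trans (proj₂ (∈-filter⁻ (λ f → y f ≟ⱽ w) {xs = H} g∈))
             (≡-sym (proj₂ (∈-filter⁻ (λ f → y f ≟ⱽ w) {xs = H} f∈)))) (joins-xy g))

        into-U : ∀ {z} → z ∈ map x at-w → z ∈ U
        into-U z∈ with ∈-map⁻ x z∈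
        ... | f , f∈ , refl = x∈U (proj₁ (∈-filter⁻ (λ f → y f ≟ⱽ w) {xs = H} f∈))

      rich-H : ∀ {u} → u ∈ U → length U ≤ deg H u
      rich-H {u} u∈ = ≤-trans (rich u∈) (subst (length (filter (joined? A u) W) ≤_) (length-nbrs H u)
        (length-mono (Uniqueₚ.filter⁺ (joined? A u) uW) λ {w} w∈ →
          let w∈W , e , e∈ , j = ∈-filter⁻ (joined? A u) {xs = W} w∈
          in nbrs⁺ {H} (e , ∈-filter⁺ hits? e∈ (incident-W e w∈W (joins⇒incident e (joins-swap e j))) , j)))

      deg-split : ∀ u → deg R u + deg H u ≤ deg A u
      deg-split u = subst (_≤ deg A u) (+-comm (deg H u) (deg R u))
        (subst (deg H u + deg R u ≤_) (length-filter-split hits? (filter (incident? u) A))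
        (+-mono-≤ (length-mono (Uniqueₚ.filter⁺ (incident? u) uH) λ e∈ →
                     let e∈H , i = ∈-filter⁻ (incident? u) {xs = H} e∈
                         e∈A , h = ∈-filter⁻ hits? {xs = A} e∈H
                     in ∈-filter⁺ hits? (∈-filter⁺ (incident? u) e∈A i) h)
                  (length-mono (Uniqueₚ.filter⁺ (incident? u) uR) λ e∈ →
                     let e∈R , i = ∈-filter⁻ (incident? u) {xs = R} e∈
                         e∈A , h = ∈-filter⁻ (¬? ∘ hits?) {xs = A} e∈R
                     in ∈-filter⁺ (¬? ∘ hits?) (∈-filter⁺ (incident? u) e∈A i) h)))

      touching-R : ∀ {e} → e ∈ H → length (filter (touches? e) R) ≤ deg R (x e)
      touching-R {e} e∈ = filter-mono (touches? e) (incident? (x e)) uR λ f∈ t → f∈ , at-x f∈ t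
        where
        not-W : ∀ {f z} → f ∈ R → Incident z f → x e ≡ z ⊎ y e ≡ z → Incident (x e) f
        not-W {f} f∈ i (inj₁ refl) = i
        not-W {f} f∈ i (inj₂ refl) = contradiction (incident-W f (y∈W e∈) i)
          (proj₂ (∈-filter⁻ (¬? ∘ hits?) {xs = A} f∈))

        at-x : ∀ {f} → f ∈ R → Touches e f → Incident (x e) f
        at-x f∈ (inj₁ i) = not-W f∈ i (incident-xy (inj₁ refl))
        at-x f∈ (inj₂ i) = not-W f∈ i (incident-xy (inj₂ refl))

      -- No edge of `R` meets `W`, so an edge of `H` loses at most `deg R (x e)` colours and keeps
      -- at least `deg H (x e)`. Its y-end has degree at most `length U` in `H`, which by richness
      -- is at most `deg H (x e)`.
      colour-heavy : ListColouring R L → ListColouring A L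
      colour-heavy γ = extend-colouring hits? A L uL γ λ L′ long →
        let δ , δ∈ , proper = bipartite-list-colouring (deg H) L′ uH
              (λ {e} e∈ → degree-x (x e) , ≤-trans (degree-y (y e)) (rich-H (x∈U e∈)))
              (λ {e} e∈ → proj₁ (long e∈) , +-cancelˡ-≤ (deg R (x e)) _ _ (begin
                deg R (x e) + deg H (x e)                         ≤⟨ deg-split (x e) ⟩
                deg A (x e)                                       ≤⟨ deg≤m (x e) ⟩
                m                                                 ≡⟨ ≡-sym (length-L e) ⟩
                length (L e)                                      ≤⟨ proj₂ (long e∈) ⟩
                length (filter (touches? e) R) + length (L′ e)    ≤⟨ +-monoˡ-≤ _ (touching-R e∈) ⟩
                deg R (x e) + length (L′ e)                       ∎))
        in δ , δ∈ , λ e∈ f∈ e≢f ie jf → proper e∈ f∈ e≢f (adjacent e∈ f∈ ie jf)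
        where open ≤-Reasoning

-- Numerical estimates and the induction for bounded width.

-- Excludes an edge between two small vertices: their degree sum, at most `k + k`, would be below
-- the `m + 2` required of heavy edges.
few-small : ∀ k m → (k + 3) ^ 2 ≤ 2 * m → k + k < m + 2
few-small k m large = *-cancelˡ-< 2 (k + k) (m + 2) (begin-strict
  2 * (k + k)                          <⟨ m<m+n _ z<s ⟩
  -- The added term is the difference to `(k + 3) ^ 2 + 4`, written as a successor to give
  -- strictness.
  2 * (k + k) + suc (k * k + 2 * k + 12) ≡⟨ identity k ⟩
  (k + 3) ^ 2 + 4                      ≤⟨ +-monoˡ-≤ 4 large ⟩
  2 * m + 4                            ≡⟨ ≡-sym (*-distribˡ-+ 2 m 2) ⟩
  2 * (m + 2)                          ∎)
  where
  open ≤-Reasoning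
  identity : ∀ k → 2 * (k + k) + suc (k * k + 2 * k + 12) ≡ (k + 3) * ((k + 3) * 1) + 4
  identity = solve-∀

-- Here `w` is at least `m + 2 - 2k`, and twice this is at least `k^2 + 2k + 13`, more than
-- `k (k + 1)`, the double of the triangle number.
many-small : ∀ k m w → (k + 3) ^ 2 ≤ 2 * m → m + 2 ≤ k + (k + w) → triangle (suc k) < w
many-small k m w large bound = *-cancelˡ-< 2 _ w (+-cancelˡ-< (2 * (k + k)) _ _ (begin-strict
  2 * (k + k) + 2 * triangle (suc k)      ≡⟨ cong (2 * (k + k) +_) (double-triangle k) ⟩
  2 * (k + k) + k * suc k                 <⟨ m<m+n _ z<s ⟩
  2 * (k + k) + k * suc k + suc (k + 12)  ≡⟨ identity k ⟩
  (k + 3) ^ 2 + 4                         ≤⟨ +-monoˡ-≤ 4 large ⟩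
  2 * m + 4                               ≡⟨ ≡-sym (*-distribˡ-+ 2 m 2) ⟩
  2 * (m + 2)                             ≤⟨ *-monoʳ-≤ 2 bound ⟩
  2 * (k + (k + w))                       ≡⟨ regroup k w ⟩
  2 * (k + k) + 2 * w                     ∎))
  where
  open ≤-Reasoning
  identity : ∀ k → 2 * (k + k) + k * suc k + suc (k + 12) ≡ (k + 3) * ((k + 3) * 1) + 4
  identity = solve-∀
  regroup : ∀ k w → 2 * (k + (k + w)) ≡ 2 * (k + k) + 2 * w
  regroup = solve-∀

module BoundedWidth (G : Graph) (k m : ℕ) (D : TreeDecomposition G) (width : WidthAtMost D k)
  (large : (k + 3) ^ 2 ≤ 2 * m) where

  open Edges G

  root : Vertex (tree D)
  root = Fin.fromℕ< (proj₁ (isTree D))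

  open Decomposed G D root using (In; in?; isolate)

  module _ (A : List (Edge G)) (uA : Unique A)
    (heavy : ∀ {e} → e ∈ A → m + 2 ≤ deg A (e₁ e) + deg A (e₂ e)) where

    Big : Vertex G → Set
    Big v = k < deg A v

    big? : Decidable Big
    big? v = k <? deg A v

    heavy-joined : ∀ {u v} → Joined A u v → m + 2 ≤ deg A u + deg A v
    heavy-joined (e , e∈ , inj₁ (refl , refl)) = heavy e∈
    heavy-joined (e , e∈ , inj₂ (refl , refl)) = ≤-trans (heavy e∈) (≤-reflexive (+-comm (deg A (e₁ e)) _))

    partner-big : ∀ {u v} → Joined A u v → ¬ Big v → Big u
    partner-big {u} {v} j small = decidable-stable (big? u) λ small′ →
      <⇒≱ (few-small k m large) (≤-trans (heavy-joined j) (+-mono-≤ (≮⇒≥ small′) (≮⇒≥ small)))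

    some-big : ∀ {e} → e ∈ A → ∃[ v ] Big v
    some-big {e} e∈ with big? (e₂ e)
    ... | yes b = _ , b
    ... | no ¬b = _ , partner-big (e , e∈ , inj₁ (refl , refl)) ¬b

    module Isolated {v t} (big-v : Big v) (v∈t : In v t)
      (isolated : ∀ {w} → Adj G v w → ¬ In w t → ¬ Big w × (∀ {x} → Adj G w x → Big x → In x t)) where

      bag-list : List (Vertex G)
      bag-list = filter (λ u → in? u t) (allFin (n G))

      bag-small : length bag-list ≤ suc k
      bag-small = subst (_≤ suc k) (countTrue-filter (bag D t) (allFin (n G))) (width t)

      N⁻ : ∀ {w} → w ∈ nbrs A v → Joined A v w
      N⁻ = nbrs⁻ {A}

      W U : List (Vertex G)
      W = filter (λ w → ¬? (in? w t)) (nbrs A v)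
      U = filter (λ u → in? u t ×-dec big? u) (allFin (n G))

      W⁻ : ∀ {w} → w ∈ W → Joined A v w × ¬ In w t
      W⁻ w∈ = let w∈N , w∉t = ∈-filter⁻ (λ w → ¬? (in? w t)) {xs = nbrs A v} w∈ in N⁻ w∈N , w∉t

      joined-adj : ∀ {u w} → Joined A u w → Adj G u w
      joined-adj (e , _ , j) = joins-adj e j

      W-small : ∀ {w} → w ∈ W → ¬ Big w
      W-small w∈ = let j , w∉t = W⁻ w∈ in proj₁ (isolated (joined-adj j) w∉t)

      W-closed : ∀ {u w} → w ∈ W → Joined A u w → u ∈ U
      W-closed {u} w∈ j = let j′ , w∉t = W⁻ w∈ in ∈-filter⁺ (λ u → in? u t ×-dec big? u) (∈-allFin u)
        ( proj₂ (isolated (joined-adj j′) w∉t) (joined-adj (joined-swap j)) (partner-big j (W-small w∈))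
        , partner-big j (W-small w∈))

      -- The bag has at most `k + 1` vertices, and one of them is `v` itself.
      bag-nbrs : length (filter (λ w → in? w t) (nbrs A v)) ≤ k
      bag-nbrs = s≤s⁻¹ (≤-trans (length-mono
          (All.tabulate fresh ∷ Uniqueₚ.filter⁺ (λ w → in? w t) (unique-nbrs uA v)) λ
          { (here refl) → ∈-filter⁺ (λ w → in? w t) (∈-allFin v) v∈t
          ; (there w∈)  → ∈-filter⁺ (λ w → in? w t) (∈-allFin _) (proj₂ (in-bag w∈)) }) bag-small)
        where
        in-bag : ∀ {w} → w ∈ filter (λ w → in? w t) (nbrs A v) → w ∈ nbrs A v × In w t
        in-bag = ∈-filter⁻ (λ w → in? w t) {xs = nbrs A v}

        fresh : ∀ {w} → w ∈ filter (λ w → in? w t) (nbrs A v) → v ≢ w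
        fresh w∈ refl with N⁻ (proj₁ (in-bag w∈))
        ... | e , _ , j = subst T (Graph.irrefl G v) (joins-adj e j)

      deg-v : deg A v ≤ k + length W
      deg-v = subst (_≤ k + length W)
        (trans (length-filter-split (λ w → in? w t) (nbrs A v)) (length-nbrs A v)) (+-monoˡ-≤ (length W) bag-nbrs)

      -- Since `deg A v` exceeds `k`, some neighbour `w₀` lies outside the bag. It is small, so
      -- heaviness of its edge to `v` forces `deg A v` up to at least `m + 2 - k`, of which at most
      -- `k` is spent inside the bag.
      W-large : triangle (suc k) < length W
      W-large = many-small k m (length W) large (begin
        m + 2              ≤⟨ heavy-joined (proj₁ (W⁻ (proj₂ w₀))) ⟩
        deg A v + deg A (proj₁ w₀) ≤⟨ +-mono-≤ deg-v (≮⇒≥ (W-small (proj₂ w₀))) ⟩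
        k + length W + k   ≡⟨ +-comm _ k ⟩
        k + (k + length W) ∎)
        where
        open ≤-Reasoning
        head-of : ∀ ws → 0 < length ws → ∃[ w ] (w ∈ ws)
        head-of (w ∷ _) _ = w , here refl

        w₀ : ∃[ w ] (w ∈ W)
        w₀ = head-of W (+-cancelˡ-< k _ _ (<-≤-trans (subst (_< deg A v) (≡-sym (+-identityʳ k)) big-v) deg-v))

      U-small : length U ≤ suc k
      U-small = ≤-trans (filter-mono (λ u → in? u t ×-dec big? u) (λ u → in? u t) (Uniqueₚ.allFin⁺ (n G))
                          λ u∈ p → u∈ , proj₁ p) bag-small

      opaque
        heavy-core : Peeling.Core _≟ⱽ_ (Joined A) (joined? A) U W
        heavy-core = Peeling.core _≟ⱽ_ (Joined A) (joined? A) (suc k) U W U-small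
          (Uniqueₚ.filter⁺ (λ w → ¬? (in? w t)) (unique-nbrs uA v)) W-large W-closed

      U-big : ∀ {u} → u ∈ U → Big u
      U-big u∈ = proj₂ (proj₂ (∈-filter⁻ (λ u → in? u t ×-dec big? u) {xs = allFin (n G)} u∈))

  module _ (L : Edge G → List ℕ) (uL : ∀ e → Unique (L e)) (length-L : ∀ e → length (L e) ≡ m)
    (deg≤m : ∀ {A} → Unique A → ∀ v → deg A v ≤ m) where

    open Reduction G

    -- Induction on the number of edges, bounded by `s`. The lists stay at full length `m`
    -- throughout; only the subgraph shrinks.
    colour : ∀ s A → length A ≤ s → Unique A → ListColouring A L
    colour _ [] _ _ = (λ _ → 0) , (λ ()) , λ ()
    colour (suc s) A@(_ ∷ _) A≤s uA with some? (λ e → deg A (e₁ e) + deg A (e₂ e) ≤? suc m) A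
    ... | inj₁ (e , e∈ , light) = colour-light A uA m L uL length-L e∈ light
          (colour s _ (s≤s⁻¹ (≤-trans (length-filter-delete (¬? ∘ (_≟ᴱ e)) e∈ λ e≢e → e≢e refl) A≤s))
             (Uniqueₚ.filter⁺ (¬? ∘ (_≟ᴱ e)) uA))
    ... | inj₂ none = colour-heavy A uA m L uL length-L (deg≤m uA) U′ W′
            -- The two sides are disjoint: `U′` consists of big vertices and `W′` of small ones.
            (λ u∈ w∈ → W-small (W′⊆W w∈) (U-big (U′⊆U u∈))) closed unique-W rich
            (colour s _ (s≤s⁻¹ (≤-trans fewer A≤s)) (Uniqueₚ.filter⁺ (¬? ∘ hits) uA))
      where
      heavy : ∀ {e} → e ∈ A → m + 2 ≤ deg A (e₁ e) + deg A (e₂ e)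
      heavy e∈ = ≤-trans (≤-reflexive (+-comm m 2)) (≰⇒> (none e∈))

      choice = isolate (big? A uA heavy) (proj₂ (some-big A uA heavy (here refl)))

      open Isolated A uA heavy (proj₁ (proj₂ (proj₂ choice))) (proj₁ (proj₂ (proj₂ (proj₂ choice))))
        (proj₂ (proj₂ (proj₂ (proj₂ choice))))

      open Peeling.Core heavy-core

      hits : Decidable (λ e → e₁ e ∈ W′ ⊎ e₂ e ∈ W′)
      hits = hits? A uA m L uL length-L (deg≤m uA) U′ W′
            (λ u∈ w∈ → W-small (W′⊆W w∈) (U-big (U′⊆U u∈))) closed unique-W rich

      -- A vertex of `W′` is a neighbour of `v`, so at least one edge is set aside and the recursive
      -- call is on a smaller subgraph.
      hit-edge : ∃[ e ] (e ∈ A × (e₁ e ∈ W′ ⊎ e₂ e ∈ W′))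
      hit-edge with W′ | nonempty | W′⊆W
      ... | w ∷ _ | _ | sub with W⁻ (sub (here refl))
      ...   | (e , e∈ , inj₁ (_ , refl)) , _ = e , e∈ , inj₂ (here refl)
      ...   | (e , e∈ , inj₂ (refl , _)) , _ = e , e∈ , inj₁ (here refl)

      fewer : length (filter (¬? ∘ hits) A) < length A
      fewer = length-filter-delete (¬? ∘ hits) (proj₁ (proj₂ hit-edge)) λ miss → miss (proj₂ (proj₂ hit-edge))

-- The lower bound and the conclusion.

degree≤maxDegree : (G : Graph) (v : Vertex G) → degree G v ≤ maxDegree G
degree≤maxDegree G v = bound (∈-map⁺ (degree G) (∈-allFin v))
  where
  bound : ∀ {d ds} → d ∈ ds → d ≤ foldr _⊔_ 0 ds
  bound (here refl)         = m≤m⊔n _ _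
  bound {ds = d′ ∷ _} (there d∈) = ≤-trans (bound d∈) (m≤n⊔m d′ _)

maxDegree≤ : (G : Graph) {b : ℕ} → (∀ v → degree G v ≤ b) → maxDegree G ≤ b
maxDegree≤ G {b} bound = go (allFin (n G))
  where
  go : ∀ vs → foldr _⊔_ 0 (map (degree G) vs) ≤ b
  go []       = z≤n
  go (v ∷ vs) = ⊔-lub (bound v) (go vs)

-- Give every edge the same list `upTo m`: the edges at a vertex receive distinct colours from it,
-- so no degree exceeds `m`.
choosable≥maxDegree : (G : Graph) (m : ℕ) → EdgeChoosable G m → maxDegree G ≤ m
choosable≥maxDegree G m choosable = maxDegree≤ G λ v → ≤-trans (degree≤deg v) (at v)
  where
  open Edges G

  γ = choosable ((λ _ → upTo m) , λ _ → Uniqueₚ.upTo⁺ m , length-upTo m)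

  shared : ∀ {e f v} → Incident v e → Incident v f → ShareEnd G e f
  shared (inj₁ p) (inj₁ q) = inj₁ (trans p (≡-sym q))
  shared (inj₁ p) (inj₂ q) = inj₂ (inj₁ (trans p (≡-sym q)))
  shared (inj₂ p) (inj₁ q) = inj₂ (inj₂ (inj₁ (trans p (≡-sym q))))
  shared (inj₂ p) (inj₂ q) = inj₂ (inj₂ (inj₂ (trans p (≡-sym q))))

  at : ∀ v → deg allEdges v ≤ m
  at v = subst₂ _≤_ (length-map (proj₁ γ) star) (length-upTo m) (length-mono
    (unique-map (proj₁ γ) (Uniqueₚ.filter⁺ (incident? v) unique-allEdges) injective) in-range)
    where
    star = filter (incident? v) allEdges

    inc : ∀ {e} → e ∈ star → Incident v e
    inc e∈ = proj₂ (∈-filter⁻ (incident? v) {xs = allEdges} e∈)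

    injective : ∀ {e f} → e ∈ star → f ∈ star → proj₁ γ e ≡ proj₁ γ f → e ≡ f
    injective {e} {f} e∈ f∈ eq = decidable-stable (e ≟ᴱ f) λ e≢f →
      proj₂ (proj₂ γ) e f e≢f (shared {e} {f} (inc e∈) (inc f∈)) eq

    in-range : ∀ {a} → a ∈ map (proj₁ γ) star → a ∈ upTo m
    in-range a∈ with ∈-map⁻ (proj₁ γ) a∈
    ... | e , _ , refl = proj₁ (proj₂ γ) e

choosable-maxDegree : (k : ℕ) (G : Graph) (D : TreeDecomposition G) → WidthAtMost D k →
  (k + 3) ^ 2 ≤ 2 * maxDegree G → EdgeChoosable G (maxDegree G)
choosable-maxDegree k G D width large (L , valid) = finish
  (BoundedWidth.colour G k (maxDegree G) D width large L (proj₁ ∘ valid) (proj₂ ∘ valid)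
    (λ uA v → ≤-trans (deg≤degree uA v) (degree≤maxDegree G v)) (length allEdges) allEdges ≤-refl unique-allEdges)
  where
  open Edges G

  finish : ListColouring allEdges L → Σ[ γ ∈ (Edge G → ℕ) ] IsLEdgeColouring G L γ
  finish (γ , γ∈ , proper) = γ , (λ e → γ∈ (∈-allEdges e)) , distinct
    where
    differ : ∀ e f {z} → e ≢ f → Incident z e → Incident z f → γ e ≢ γ f
    differ e f e≢f = proper (∈-allEdges e) (∈-allEdges f) e≢f

    distinct : ∀ e f → e ≢ f → ShareEnd G e f → γ e ≢ γ f
    distinct e f e≢f (inj₁ p)                = differ e f e≢f (inj₁ p) (inj₁ refl)
    distinct e f e≢f (inj₂ (inj₁ p))         = differ e f e≢f (inj₁ p) (inj₂ refl)
    distinct e f e≢f (inj₂ (inj₂ (inj₁ p)))  = differ e f e≢f (inj₂ p) (inj₁ refl)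
    distinct e f e≢f (inj₂ (inj₂ (inj₂ p)))  = differ e f e≢f (inj₂ p) (inj₂ refl)

theorem1 : (k : ℕ) (G : Graph) → TreewidthEq G k →
    (k + 3) ^ 2 ≤ 2 * maxDegree G →
    ListChromaticIndexEq G (maxDegree G)
theorem1 k G ((D , width) , _) large = choosable-maxDegree k G D width large , choosable≥maxDegree G
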